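{- There is an $n^{3\Delta+O(1)}$-delay enumeration algorithm that, given a connected graph $G$ with $n$ vertices and maximum degree $\Delta$, outputs all minimal connected dominating sets of $G$ (Minimal Connected Dominating Set Enumeration).
   Context: Graphs are finite, undirected and simple. A dominating set of $G$ is a set $D\subseteq V(G)$ such that every vertex in $V(G)\setminus D$ has a neighbor in $D$; it is connected if the induced subgraph $G[D]$ is connected. A connected dominating set is minimal if no proper subset of it is a connected dominating set. Minimal Connected Dominating Set Enumeration is the problem of outputting, each exactly once, all minimal connected dominating sets of the input graph. An enumeration algorithm has delay $D$ (is a $D$-delay algorithm) if the time elapsed between every two consecutive outputs, including pre-processing and post-processing, is at most $D$. The constant hidden in $O(1)$ is absolute. -}

module Defs where

open import Data.Bool.Base using (Bool; true; false)
open import Data.Nat.Base using (ℕ; suc; _+_; _⊔_; _≤_)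
open import Data.Fin.Base using (Fin; zero)
open import Data.Fin.Subset using (Subset; _∈_; _∉_; _⊂_; Nonempty; ∣_∣; ⊤)
open import Data.List.Base as List using (List; []; _∷_; _++_; [_]; replicate)
open import Data.List.Membership.Propositional using () renaming (_∈_ to _∈ˡ_)
open import Data.List.Relation.Unary.All using (All)
open import Data.List.Relation.Unary.Unique.Propositional using (Unique)
open import Data.Product.Base using (∃-syntax; _×_)
open import Data.Vec.Base as Vec using (Vec; lookup; tabulate; toList; _[_]≔_)
open import Function.Bundles using (_⇔_)
open import Relation.Binary.Construct.Closure.ReflexiveTransitive using (Star)
open import Relation.Binary.PropositionalEquality using (_≡_; _≢_)
open import Relation.Nullary using (¬_)

record Graph (n : ℕ) : Set where
  field
    adj       : Fin n → Fin n → Bool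
    adj-sym   : ∀ u v → adj u v ≡ adj v u
    adj-irref : ∀ u → adj u u ≡ false

  Adj : Fin n → Fin n → Set
  Adj u v = adj u v ≡ true

  neighbours : Fin n → Subset n
  neighbours u = tabulate (adj u)

  degree : Fin n → ℕ
  degree u = ∣ neighbours u ∣

  maxDegree : ℕ
  maxDegree = List.foldr _⊔_ 0 (List.map degree (List.allFin n))

open Graph public

module _ {n : ℕ} (G : Graph n) where

  -- The edge relation of the induced subgraph G[D].
  AdjIn : Subset n → Fin n → Fin n → Set
  AdjIn D u v = u ∈ D × v ∈ D × Adj G u v

  -- G[D] is connected; the graph without vertices does not count as connected.
  ConnectedOn : Subset n → Set
  ConnectedOn D = Nonempty D × (∀ {u v} → u ∈ D → v ∈ D → Star (AdjIn D) u v)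

  Connected : Set
  Connected = ConnectedOn ⊤

  Dominating : Subset n → Set
  Dominating D = ∀ v → v ∉ D → ∃[ u ] u ∈ D × Adj G v u

  ConnectedDominating : Subset n → Set
  ConnectedDominating D = Dominating D × ConnectedOn D

  MinimalConnectedDominating : Subset n → Set
  MinimalConnectedDominating D =
    ConnectedDominating D × (∀ D′ → D′ ⊂ D → ¬ ConnectedDominating D′)

-- The model of computation: N. D. Jones' WHILE language over binary trees
-- ("Computability and Complexity from a Programming Perspective", MIT Press,
-- 1997), extended with a conditional and with a command producing an output.
-- Trees are manipulated by reference, so every elementary operation takes
-- constant time on a RAM or pointer machine; there is no unit-cost arithmetic
-- and no unit-cost comparison of trees.

data Tree : Set where
  nil  : Tree
  cons : Tree → Tree → Tree

size : Tree → ℕ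
size nil        = 1
size (cons s t) = suc (size s + size t)

hd tl : Tree → Tree
hd nil        = nil
hd (cons s t) = s
tl nil        = nil
tl (cons s t) = t

Var : ℕ → Set
Var = Fin

Store : ℕ → Set
Store k = Vec Tree k

data Expr (k : ℕ) : Set where
  var   : Var k → Expr k
  `nil  : Expr k
  `cons : Expr k → Expr k → Expr k
  `hd   : Expr k → Expr k
  `tl   : Expr k → Expr k

data Cmd (k : ℕ) : Set where
  skip   : Cmd k
  _:=_   : Var k → Expr k → Cmd k
  _⨾_    : Cmd k → Cmd k → Cmd k
  ite    : Expr k → Cmd k → Cmd k → Cmd k
  while  : Expr k → Cmd k → Cmd k
  output : Expr k → Cmd k

infix  6 _:=_
infixr 5 _⨾_

eval : ∀ {k} → Expr k → Store k → Tree
eval (var x)     σ = lookup σ x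
eval `nil        σ = nil
eval (`cons e f) σ = cons (eval e σ) (eval f σ)
eval (`hd e)     σ = hd (eval e σ)
eval (`tl e)     σ = tl (eval e σ)

cost : ∀ {k} → Expr k → ℕ
cost (var x)     = 1
cost `nil        = 1
cost (`cons e f) = suc (cost e + cost f)
cost (`hd e)     = suc (cost e)
cost (`tl e)     = suc (cost e)

-- An execution is recorded as the sequence of its time units and outputs.
data Event : Set where
  tick : Event
  out  : Tree → Event

Trace : Set
Trace = List Event

ticks : ℕ → Trace
ticks m = replicate m tick

-- c ⊢ σ ⇓ σ′ ∣ τ: started in σ, the command c halts in σ′ with trace τ.
-- In tests, nil is false and every other tree is true. An output takes time
-- proportional to the size of the tree written, not just to the reference.
data _⊢_⇓_∣_ {k : ℕ} : Cmd k → Store k → Store k → Trace → Set where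
  ⇓skip : ∀ {σ} → skip ⊢ σ ⇓ σ ∣ ticks 1
  ⇓:= : ∀ {σ x e} → (x := e) ⊢ σ ⇓ (σ [ x ]≔ eval e σ) ∣ ticks (suc (cost e))
  ⇓⨾ : ∀ {σ σ′ σ″ c d τ τ′} →
    c ⊢ σ ⇓ σ′ ∣ τ → d ⊢ σ′ ⇓ σ″ ∣ τ′ → (c ⨾ d) ⊢ σ ⇓ σ″ ∣ (τ ++ τ′)
  ⇓ite-true : ∀ {σ σ′ e c d τ} → eval e σ ≢ nil →
    c ⊢ σ ⇓ σ′ ∣ τ → ite e c d ⊢ σ ⇓ σ′ ∣ (ticks (suc (cost e)) ++ τ)
  ⇓ite-false : ∀ {σ σ′ e c d τ} → eval e σ ≡ nil →
    d ⊢ σ ⇓ σ′ ∣ τ → ite e c d ⊢ σ ⇓ σ′ ∣ (ticks (suc (cost e)) ++ τ)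
  ⇓while-true : ∀ {σ σ′ σ″ e c τ τ′} → eval e σ ≢ nil →
    c ⊢ σ ⇓ σ′ ∣ τ → while e c ⊢ σ′ ⇓ σ″ ∣ τ′ →
    while e c ⊢ σ ⇓ σ″ ∣ (ticks (suc (cost e)) ++ τ ++ τ′)
  ⇓while-false : ∀ {σ e c} → eval e σ ≡ nil →
    while e c ⊢ σ ⇓ σ ∣ ticks (suc (cost e))
  ⇓output : ∀ {σ e} →
    output e ⊢ σ ⇓ σ ∣ (ticks (cost e + size (eval e σ)) ++ [ out (eval e σ) ])

record Program : Set where
  constructor program
  field
    {auxVars} : ℕ
    body      : Cmd (suc auxVars)

-- The input is placed in variable 0; all other variables start as nil.
_on_↝_ : Program → Tree → Trace → Set
program {m} c on t ↝ τ = ∃[ σ ] c ⊢ t Vec.∷ Vec.replicate m nil ⇓ σ ∣ τ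

outputs : Trace → List Tree
outputs []          = []
outputs (tick ∷ τ)  = outputs τ
outputs (out t ∷ τ) = t ∷ outputs τ

-- The time before the first output (or before halting, if there is none),
-- between consecutive outputs, and from the last output to halting; the
-- accumulator is the time already elapsed since the previous output.
delaysFrom : ℕ → Trace → List ℕ
delaysFrom m []          = m ∷ []
delaysFrom m (tick ∷ τ)  = delaysFrom (suc m) τ
delaysFrom m (out _ ∷ τ) = m ∷ delaysFrom 0 τ

delays : Trace → List ℕ
delays = delaysFrom 0

-- Duplicates are excluded before encoding, so enc should be injective for
-- "each exactly once" to hold of the trees actually written.
EnumeratesWithDelay :
  {A : Set} → Program → Tree → (A → Tree) → (A → Set) → ℕ → Set
EnumeratesWithDelay P t enc Sol b =
  ∃[ τ ] ∃[ xs ]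
    P on t ↝ τ ×
    outputs τ ≡ List.map enc xs ×
    Unique xs ×
    (∀ x → x ∈ˡ xs ⇔ Sol x) ×
    All (_≤ b) (delays τ)

encodeBool : Bool → Tree
encodeBool false = nil
encodeBool true  = cons nil nil

encodeList : {A : Set} → (A → Tree) → List A → Tree
encodeList enc = List.foldr (λ x t → cons (enc x) t) nil

encodeSubset : ∀ {n} → Subset n → Tree
encodeSubset D = encodeList encodeBool (toList D)

encodeGraph : ∀ {n} → Graph n → Tree
encodeGraph {n} G =
  encodeList (λ u → encodeSubset (neighbours G u)) (List.allFin n)

{-# OPTIONS --safe #-}
-- Let D and E be minimal connected dominating sets and v a vertex of D outside E. The graph
-- G[D ∖ v] has at most deg v pieces: its components, each containing a neighbour of v, and the
-- neighbours of v that have lost their dominator. One vertex of E restores the domination near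
-- each of them, and while the set is disconnected a walk through E meets, within two vertices,
-- another component. Hence adding some X ⊆ (D ∖ v) ∪ E with |X| = 3 deg v (repetitions allowed)
-- gives a connected dominating set, and minimising it yields a solution M with M ∖ E strictly
-- smaller than D ∖ E. So every solution is reached from every other one by the moves
-- "remove v, add 3 deg v vertices, minimise", of which there are n^(3Δ + O(1)).
-- The enumerator keeps a queue and a trie of the solutions met so far; it outputs the head of
-- the queue and then carries out all its moves, so that every delay pays for one set of moves.
module Submission where

open import Defs
open import Data.Bool.Base using (Bool; true; false; _∧_)
import Data.Bool.Properties as Bool
open import Data.Nat.Base using (ℕ; zero; suc; _+_; _*_; _^_; _⊔_; _∸_; _≤_; _<_; z≤n; s≤s; NonZero; >-nonZero)
open import Data.Nat.Properties hiding (_≟_)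
open import Data.Fin.Base as Fin using (Fin; zero; suc; toℕ; fromℕ<)
open import Data.Fin.Patterns using (0F; 1F; 2F)
open import Data.Fin.Properties using (_≟_; toℕ<n; toℕ-fromℕ<; toℕ-injective; pigeonhole; combine-injective)
open import Data.Fin.Subset using (Subset; _∈_; _∉_; _⊆_; ∣_∣; _∪_; _∩_; ∁) renaming (⊤ to ⊤ˢ)
open import Data.Fin.Subset.Properties
open import Data.List.Base as List using (List; []; _∷_; length; _++_; map; replicate; allFin; _∷ʳ_; _∷ʳ′_; initLast)
open import Data.List.Properties using (length-map; length-++; length-tabulate; foldr-preservesᵒ; ++-assoc)
open import Data.List.Membership.Propositional using () renaming (_∈_ to _∈ˡ_; _∉_ to _∉ˡ_)
open import Data.List.Membership.Propositional.Properties using (∈-map⁺; ∈-map⁻; ∈-allFin; ∈-lookup; ∈-++⁺ʳ)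
open import Data.List.Relation.Binary.Permutation.Propositional using (_↭_; ↭⇒↭ₛ; ↭-sym)
open import Data.List.Relation.Binary.Permutation.Propositional.Properties using (∈-resp-↭; shift)
import Data.List.Relation.Binary.Permutation.Setoid.Properties as ↭ₛ
open import Data.List.Relation.Unary.All as All using (All; []; _∷_)
open import Data.List.Relation.Unary.All.Properties using (++⁺; map⁺; replicate⁺)
open import Data.List.Relation.Unary.AllPairs using ([]; _∷_)
open import Data.List.Relation.Unary.Any as Any using (here; there)
open import Data.List.Relation.Unary.Unique.Propositional using (Unique)
open import Data.Product.Base using (∃; ∃-syntax; _×_; _,_; proj₁; proj₂)
open import Data.Sum.Base using (_⊎_; inj₁; inj₂; [_,_]′)
open import Data.Unit.Base using (⊤; tt)
open import Data.Vec.Base as Vec using (Vec; []; _∷_; lookup; _[_]≔_; here; there)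
open import Data.Vec.Properties using ([]=⇒lookup; lookup⇒[]=; []≔-updates; []≔-minimal; lookup∘tabulate; lookup∘updateAt; lookup∘updateAt′; ≡-dec)
open import Function.Base using (_∘_; id)
open import Function.Bundles using (mk⇔)
open import Relation.Binary.Construct.Closure.ReflexiveTransitive as Star using (Star; ε; _◅_; _◅◅_)
open import Relation.Binary.PropositionalEquality
open import Relation.Nullary using (¬_; yes; no; contradiction)

-- A first-order language compiled to WHILE

-- The number 3 deg v is made up of deg v vertices that restore domination and two for each of the
-- deg v - 1 mergers of components; the last two are padding, so that every move inserts exactly as
-- many vertices as the machine generates. The machine has neither arithmetic nor comparison, and
-- delays are counted in single time units. Hence the algorithm is written in a small language of
-- folds with exact step counts and a syntactic bound `coef * N ^ deg * M ^ dep`, where N = n and M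
-- = n^(3Δ + 2) bounds the lists of candidate sets. Folds over such lists are never nested, so M
-- enters once and all else costs n^O(1). Queue and trie may become exponentially large, but
-- handling one candidate touches only the front of the queue and one path of length n in the trie.
-- Termination rests on there being at most 2^n subsets; completeness rests on the queue being empty
-- at the end, when every solution written has been expanded.

cons≢nil : ∀ {s t} → cons s t ≢ nil
cons≢nil ()

-- A fold runs over the spine of a list or, for clock, over the numeral n, where n is the number
-- of vertices. Its body finds the rest of the list (including the current element) in variable 0
-- and the accumulator in variable 1. In a clock fold the rest is num (suc k) with k descending
-- from n − 1 to 0, so that its tail serves as an index into lists of length n.
data Src (m : ℕ) : Set where
  clock : Src m
  from  : Expr m → Src m

data Code : ℕ → Set where
  ret  : ∀ {m} → Expr m → Code m
  bind : ∀ {m} → Code m → Code (suc m) → Code m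
  cond : ∀ {m} → Expr m → Code m → Code m → Code m
  fold : ∀ {m} → Src m → Expr m → Code (suc (suc m)) → Code m
  call : ∀ {m k} → Code k → Vec (Expr m) k → Code m

num : ℕ → Tree
num zero    = nil
num (suc k) = cons nil (num k)

foldTree : (Tree → Tree → Tree) → Tree → Tree → Tree
foldTree f nil          a = a
foldTree f l@(cons h t) a = foldTree f t (f l a)

select : {A : Set} → Tree → A → A → A
select nil        x y = y
select (cons _ _) x y = x

evals : ∀ {m k} → Vec (Expr m) k → Store m → Store k
evals []       ρ = []
evals (e ∷ es) ρ = eval e ρ ∷ evals es ρ

access : ∀ {m} → Var m → Expr 3 → Expr 3
access zero    e = `hd e
access (suc i) e = access i (`tl e)

translate : ∀ {m} → Expr m → Expr 3
translate (var i)     = access i (var 1F)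
translate `nil        = `nil
translate (`cons e f) = `cons (translate e) (translate f)
translate (`hd e)     = `hd (translate e)
translate (`tl e)     = `tl (translate e)

translateSrc : ∀ {m} → Src m → Expr 3
translateSrc clock    = var 2F
translateSrc (from e) = translate e

pushes : ∀ {m k} → Vec (Expr m) k → Expr 3
pushes []       = var 1F
pushes (e ∷ es) = `cons (translate e) (pushes es)

pops : ℕ → Expr 3 → Expr 3
pops zero    e = e
pops (suc k) e = pops k (`tl e)

advance : Expr 3
advance = `cons (`tl (`hd (var 1F))) (`cons (var 0F) (`tl (`tl (var 1F))))

-- Variable 0 receives the result, variable 1 holds the environment as a list, variable 2 num n.
compile : ∀ {m} → Code m → Cmd 3
compile (ret e)      = 0F := translate e
compile (bind p q)   =
  compile p ⨾ 1F := `cons (var 0F) (var 1F) ⨾ compile q ⨾ 1F := `tl (var 1F)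
compile (cond e p q) = ite (translate e) (compile p) (compile q)
compile (fold s e p) =
  1F := `cons (translateSrc s) (`cons (translate e) (var 1F)) ⨾
  while (`hd (var 1F)) (compile p ⨾ 1F := advance) ⨾
  0F := `hd (`tl (var 1F)) ⨾
  1F := `tl (`tl (var 1F))
-- The callee works on its arguments alone, stacked on top of the caller's environment, so its code
-- does not depend on where it is called.
compile (call {k = k} p es) =
  1F := pushes es ⨾ compile p ⨾ 1F := pops k (var 1F)

-- The 3 pays for the loop test, which is made once more when the list is exhausted.
foldSteps : (Tree → Tree → Tree) → (Tree → Tree → ℕ) → Tree → Tree → ℕ
foldSteps f c nil          a = 3
foldSteps f c l@(cons h t) a =
  3 + ((c l a + suc (cost advance)) + foldSteps f c t (f l a))

-- Denotation, exact step counts and correctness of the compiler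

module Semantics (N : ℕ) where

  source : ∀ {m} → Src m → Store m → Tree
  source clock    ρ = num N
  source (from e) ρ = eval e ρ

  ⟦_⟧ : ∀ {m} → Code m → Store m → Tree
  ⟦ ret e ⟧      ρ = eval e ρ
  ⟦ bind p q ⟧   ρ = ⟦ q ⟧ (⟦ p ⟧ ρ ∷ ρ)
  ⟦ cond e p q ⟧ ρ = select (eval e ρ) (⟦ p ⟧ ρ) (⟦ q ⟧ ρ)
  ⟦ fold s e p ⟧ ρ = foldTree (λ l a → ⟦ p ⟧ (l ∷ a ∷ ρ)) (source s ρ) (eval e ρ)
  ⟦ call p es ⟧  ρ = ⟦ p ⟧ (evals es ρ)

  -- Exact rather than an upper bound. In `bind`, 4 and 3 pay for pushing and popping the bound
  -- value; in `fold`, 8 pays for extracting the result and restoring the environment.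
  steps : ∀ {m} → Code m → Store m → ℕ
  steps (ret e)      ρ = suc (cost (translate e))
  steps (bind p q)   ρ = steps p ρ + (4 + (steps q (⟦ p ⟧ ρ ∷ ρ) + 3))
  steps (cond e p q) ρ =
    suc (cost (translate e)) + select (eval e ρ) (steps p ρ) (steps q ρ)
  steps (fold s e p) ρ =
    suc (suc (cost (translateSrc s) + suc (cost (translate e) + 1))) +
    (foldSteps (λ l a → ⟦ p ⟧ (l ∷ a ∷ ρ)) (λ l a → steps p (l ∷ a ∷ ρ))
      (source s ρ) (eval e ρ) + 8)
  steps (call {k = k} p es) ρ =
    suc (cost (pushes es)) + (steps p (evals es ρ) + suc (cost (pops k (var 1F))))

  Env : ∀ {m} → Store m → Tree → Tree
  Env []      r = r
  Env (a ∷ ρ) r = cons a (Env ρ r)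

  state : ∀ {m} → Tree → Store m → Tree → Store 3
  state x ρ r = x ∷ Env ρ r ∷ num N ∷ []

  eval-access : ∀ {m} (i : Var m) e σ (ρ : Store m) r → eval e σ ≡ Env ρ r →
                eval (access i e) σ ≡ Vec.lookup ρ i
  eval-access zero    e σ (a ∷ ρ) r eq = cong hd eq
  eval-access (suc i) e σ (a ∷ ρ) r eq = eval-access i (`tl e) σ ρ r (cong tl eq)

  eval-translate : ∀ {m} (e : Expr m) x ρ r →
                   eval (translate e) (state x ρ r) ≡ eval e ρ
  eval-translate (var i)     x ρ r = eval-access i (var 1F) (state x ρ r) ρ r refl
  eval-translate `nil        x ρ r = refl
  eval-translate (`cons e f) x ρ r =
    cong₂ cons (eval-translate e x ρ r) (eval-translate f x ρ r)
  eval-translate (`hd e)     x ρ r = cong hd (eval-translate e x ρ r)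
  eval-translate (`tl e)     x ρ r = cong tl (eval-translate e x ρ r)

  eval-translateSrc : ∀ {m} (s : Src m) x ρ r →
                      eval (translateSrc s) (state x ρ r) ≡ source s ρ
  eval-translateSrc clock    x ρ r = refl
  eval-translateSrc (from e) x ρ r = eval-translate e x ρ r

  eval-pushes : ∀ {m k} (es : Vec (Expr m) k) x ρ r →
                eval (pushes es) (state x ρ r) ≡ Env (evals es ρ) (Env ρ r)
  eval-pushes []       x ρ r = refl
  eval-pushes (e ∷ es) x ρ r =
    cong₂ cons (eval-translate e x ρ r) (eval-pushes es x ρ r)

  eval-pops : ∀ {k} e σ (ρ : Store k) r → eval e σ ≡ Env ρ r →
              eval (pops k e) σ ≡ r
  eval-pops e σ []      r eq = eq
  eval-pops e σ (a ∷ ρ) r eq = eval-pops (`tl e) σ ρ r (cong tl eq)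

  Run : Cmd 3 → Store 3 → Store 3 → ℕ → Set
  Run c σ σ′ t = c ⊢ σ ⇓ σ′ ∣ ticks t

  ticks-+ : ∀ a b → ticks a ++ ticks b ≡ ticks (a + b)
  ticks-+ zero    b = refl
  ticks-+ (suc a) b = cong (tick ∷_) (ticks-+ a b)

  retick : ∀ {c : Cmd 3} {σ σ′ τ τ′} → τ ≡ τ′ → c ⊢ σ ⇓ σ′ ∣ τ → c ⊢ σ ⇓ σ′ ∣ τ′
  retick refl r = r

  seq : ∀ {c d σ σ′ σ″ a b} → Run c σ σ′ a → Run d σ′ σ″ b → Run (c ⨾ d) σ σ″ (a + b)
  seq {a = a} {b} p q = retick (ticks-+ a b) (⇓⨾ p q)

  assign : ∀ {x e σ v} → eval e σ ≡ v → Run (x := e) σ (σ Vec.[ x ]≔ v) (suc (cost e))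
  assign refl = ⇓:=

  ite-select : ∀ {e c d σ t x y a b} → eval e σ ≡ t → ∀ {ρ} →
    Run c σ (x ∷ ρ) a → Run d σ (y ∷ ρ) b →
    Run (ite e c d) σ (select t x y ∷ ρ) (suc (cost e) + select t a b)
  ite-select {e} {t = nil} {b = b} eq p q =
    retick (ticks-+ (suc (cost e)) b) (⇓ite-false eq q)
  ite-select {e} {t = cons _ _} {a = a} eq p q =
    retick (ticks-+ (suc (cost e)) a)
      (⇓ite-true (λ z → cons≢nil (trans (sym eq) z)) p)

  while-cons : ∀ {e c σ σ′ σ″ a b h t} → eval e σ ≡ cons h t →
    Run c σ σ′ a → Run (while e c) σ′ σ″ b → Run (while e c) σ σ″ (suc (cost e) + (a + b))
  while-cons {e} {a = a} {b} eq p q =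
    retick
      (trans (cong (ticks (suc (cost e)) ++_) (ticks-+ a b)) (ticks-+ (suc (cost e)) (a + b)))
      (⇓while-true (λ z → cons≢nil (trans (sym eq) z)) p q)

  runFold : ∀ {m} (f : Tree → Tree → Tree) c s (ρ : Store m) r →
    (∀ l a x → Run s (state x (l ∷ a ∷ ρ) r) (state (f l a) (l ∷ a ∷ ρ) r) (c l a)) →
    ∀ l a x → Run (while (`hd (var 1F)) (s ⨾ 1F := advance)
      ⨾ 0F := `hd (`tl (var 1F)) ⨾ 1F := `tl (`tl (var 1F)))
      (state x (l ∷ a ∷ ρ) r) (state (foldTree f l a) ρ r) (foldSteps f c l a + 8)
  runFold f c s ρ r body = λ l a x →
    seq (proj₂ (loop l a x)) (seq {a = 4} {4} (assign refl) (assign refl))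
    where
    loop : ∀ l a x → ∃[ y ]
      Run (while (`hd (var 1F)) (s ⨾ 1F := advance))
        (state x (l ∷ a ∷ ρ) r) (state y (nil ∷ foldTree f l a ∷ ρ) r) (foldSteps f c l a)
    loop nil          a x = x , ⇓while-false refl
    loop l@(cons h t) a x with loop t (f l a) (f l a)
    ... | y , rest = y , while-cons {b = foldSteps f c t (f l a)} refl
                           (seq {b = suc (cost advance)} (body l a x) (assign refl)) rest

  -- The environment and whatever lies beneath it come back unchanged, which makes runs compose. `x`
  -- is arbitrary because no code reads the result register before writing it.
  run : ∀ {m} (p : Code m) ρ r x →
        Run (compile p) (state x ρ r) (state (⟦ p ⟧ ρ) ρ r) (steps p ρ)
  run (ret e)    ρ r x = assign (eval-translate e x ρ r)
  run (bind p q) ρ r x =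
    seq (run p ρ r x) (seq {a = 4} (assign refl)
      (seq {b = 3} (run q (⟦ p ⟧ ρ ∷ ρ) r _) (assign refl)))
  run (cond e p q) ρ r x =
    ite-select (eval-translate e x ρ r) (run p ρ r x) (run q ρ r x)
  run (fold s e p) ρ r x =
    seq {a = suc (suc (cost (translateSrc s) + suc (cost (translate e) + 1)))}
      (assign (cong₂ cons (eval-translateSrc s x ρ r)
        (cong₂ cons (eval-translate e x ρ r) refl)))
      (runFold _ (λ l a → steps p (l ∷ a ∷ ρ)) (compile p) ρ r
        (λ l a → run p (l ∷ a ∷ ρ) r) (source s ρ) (eval e ρ) x)
  run (call p es) ρ r x =
    seq {b = steps p (evals es ρ) + _} (assign (eval-pushes es x ρ r))
      (seq (run p (evals es ρ) (Env ρ r) x)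
        (assign (eval-pops (var 1F) _ (evals es ρ) (Env ρ r) refl)))

-- Syntactic bounds on running times

spine : Tree → ℕ
spine nil        = 0
spine (cons s t) = suc (spine t)

spine-num : ∀ k → spine (num k) ≡ k
spine-num zero    = refl
spine-num (suc k) = cong suc (spine-num k)

-- Flat code folds over the clock only, so it is within bounds on every store and no list length has
-- to be tracked.
flat : ∀ {m} → Code m → Bool
flat (ret e)           = true
flat (bind p q)        = flat p ∧ flat q
flat (cond e p q)      = flat p ∧ flat q
flat (fold clock e p)  = flat p
flat (fold (from _) e p) = false
flat (call p es)       = flat p

srcDeg srcDep : ∀ {m} → Src m → ℕ
srcDeg clock    = 1
srcDeg (from _) = 0
srcDep clock    = 0
srcDep (from _) = 1

-- Data of the monomial `coef * N ^ deg * M ^ dep` bounding the steps: `deg` is the nesting depth of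
-- clock folds, `dep` that of list folds.
coef deg dep : ∀ {m} → Code m → ℕ
coef (ret e)      = suc (cost (translate e))
coef (bind p q)   = coef p + (4 + (coef q + 3))
coef (cond e p q) = suc (cost (translate e)) + (coef p + coef q)
coef (fold s e p) =
  suc (suc (cost (translateSrc s) + suc (cost (translate e) + 1))) +
  (((3 + (coef p + suc (cost advance))) + 3) + 8)
coef (call {k = k} p es) = suc (cost (pushes es)) + (coef p + suc (cost (pops k (var 1F))))

deg (ret e)      = 0
deg (bind p q)   = deg p ⊔ deg q
deg (cond e p q) = deg p ⊔ deg q
deg (fold s e p) = srcDeg s + deg p
deg (call p es)  = deg p

dep (ret e)      = 0
dep (bind p q)   = dep p ⊔ dep q
dep (cond e p q) = dep p ⊔ dep q
dep (fold s e p) = srcDep s + dep p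
dep (call p es)  = dep p

OkFold : (Tree → Tree → Tree) → (Tree → Tree → Set) → Tree → Tree → Set
OkFold f ok nil          a = ⊤
OkFold f ok l@(cons h t) a = ok l a × OkFold f ok t (f l a)

-- Ok p ρ: every list over which p folds when run on ρ has length at most M.
module Cost (N M : ℕ) (1≤N : 1 ≤ N) (1≤M : 1 ≤ M) where
  open Semantics N

  OkSrc : ∀ {m} → Src m → Store m → Set
  OkSrc clock    ρ = ⊤
  OkSrc (from e) ρ = spine (eval e ρ) ≤ M

  Ok : ∀ {m} → Code m → Store m → Set
  Ok (ret e)      ρ = ⊤
  Ok (bind p q)   ρ = Ok p ρ × Ok q (⟦ p ⟧ ρ ∷ ρ)
  Ok (cond e p q) ρ = Ok p ρ × Ok q ρ
  Ok (fold s e p) ρ = OkSrc s ρ ×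
    OkFold (λ l a → ⟦ p ⟧ (l ∷ a ∷ ρ)) (λ l a → Ok p (l ∷ a ∷ ρ)) (source s ρ) (eval e ρ)
  Ok (call p es)  ρ = Ok p (evals es ρ)

  ∧-split : ∀ {a b} → a ∧ b ≡ true → a ≡ true × b ≡ true
  ∧-split {true} {true} refl = refl , refl

  okFold : ∀ f {ok : Tree → Tree → Set} → (∀ l a → ok l a) → ∀ l a → OkFold f ok l a
  okFold f h nil        a = tt
  okFold f h (cons x t) a = h _ _ , okFold f h t _

  flat⇒Ok : ∀ {m} (p : Code m) → flat p ≡ true → ∀ ρ → Ok p ρ
  flat⇒Ok (ret e)      fl ρ = tt
  flat⇒Ok (bind p q)   fl ρ =
    flat⇒Ok p (proj₁ (∧-split fl)) ρ , flat⇒Ok q (proj₂ (∧-split {flat p} fl)) _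
  flat⇒Ok (cond e p q) fl ρ =
    flat⇒Ok p (proj₁ (∧-split fl)) ρ , flat⇒Ok q (proj₂ (∧-split {flat p} fl)) ρ
  flat⇒Ok (fold clock e p) fl ρ = tt , okFold _ (λ l a → flat⇒Ok p fl _) (num N) (eval e ρ)
  flat⇒Ok (call p es)  fl ρ = flat⇒Ok p fl (evals es ρ)

  P : ℕ → ℕ → ℕ
  P d e = N ^ d * M ^ e

  instance
    N≢0 : NonZero N
    N≢0 = >-nonZero 1≤N
    M≢0 : NonZero M
    M≢0 = >-nonZero 1≤M

  1≤P : ∀ d e → 1 ≤ P d e
  1≤P d e = *-mono-≤ (m^n>0 N d) (m^n>0 M e)

  P-mono : ∀ {d d′ e e′} → d ≤ d′ → e ≤ e′ → P d e ≤ P d′ e′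
  P-mono p q = *-mono-≤ (^-monoʳ-≤ N p) (^-monoʳ-≤ M q)

  record Bound (a x d e : ℕ) : Set where
    constructor bound
    field unbound : a ≤ x * P d e
  open Bound public

  const≤ : ∀ k d e → Bound k k d e
  const≤ k d e =
    bound (≤-trans (≤-reflexive (sym (*-identityʳ k))) (*-monoʳ-≤ k (1≤P d e)))

  infixr 5 _⊕_
  _⊕_ : ∀ {a b x y d e} → Bound a x d e → Bound b y d e → Bound (a + b) (x + y) d e
  _⊕_ {x = x} {y} {d} {e} (bound p) (bound q) =
    bound (≤-trans (+-mono-≤ p q) (≤-reflexive (sym (*-distribʳ-+ (P d e) x y))))

  widen : ∀ {a x d d′ e e′} → d ≤ d′ → e ≤ e′ → Bound a x d e → Bound a x d′ e′
  widen {x = x} q r (bound p) = bound (≤-trans p (*-monoʳ-≤ x (P-mono q r)))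

  lower : ∀ {a b x d e} → a ≤ b → Bound b x d e → Bound a x d e
  lower p (bound q) = bound (≤-trans p q)

  source-spine : ∀ {m} (s : Src m) ρ → OkSrc s ρ → ∀ d e →
    spine (source s ρ) * P d e ≤ P (srcDeg s + d) (srcDep s + e)
  source-spine clock    ρ ok d e =
    ≤-reflexive (trans (cong (_* P d e) (spine-num N)) (sym (*-assoc N (N ^ d) (M ^ e))))
  source-spine (from x) ρ ok d e = ≤-trans (*-monoˡ-≤ (P d e) ok)
    (≤-reflexive (trans (sym (*-assoc M (N ^ d) (M ^ e)))
      (trans (cong (_* M ^ e) (*-comm M (N ^ d))) (*-assoc (N ^ d) M (M ^ e)))))

  select-≤ : ∀ t {a b x y d e} → Bound a x d e → Bound b y d e →
             Bound (select t a b) (x + y) d e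
  select-≤ nil {x = x} {y} {d} {e} p (bound q) =
    bound (≤-trans q (*-monoˡ-≤ (P d e) (m≤n+m y x)))
  select-≤ (cons _ _) {x = x} {y} {d} {e} (bound p) q =
    bound (≤-trans p (*-monoˡ-≤ (P d e) (m≤m+n x y)))

  foldSteps-≤ : ∀ f c (ok : Tree → Tree → Set) B → (∀ l a → ok l a → c l a ≤ B) →
    ∀ l a → OkFold f ok l a →
    foldSteps f c l a ≤ spine l * (3 + (B + suc (cost advance))) + 3
  foldSteps-≤ f c ok B h nil          a _ = ≤-refl
  foldSteps-≤ f c ok B h l@(cons x t) a (o , os) =
    ≤-trans (+-monoʳ-≤ 3 (+-mono-≤ (+-monoˡ-≤ (suc (cost advance)) (h l a o))
      (foldSteps-≤ f c ok B h t (f l a) os)))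
    (≤-reflexive (sym (+-assoc (3 + (B + suc (cost advance))) (spine t * _) 3)))

  steps-≤ : ∀ {m} (p : Code m) ρ → Ok p ρ → Bound (steps p ρ) (coef p) (deg p) (dep p)
  steps-≤ (ret e)    ρ ok = const≤ (suc (cost (translate e))) 0 0
  steps-≤ (bind p q) ρ (okp , okq) =
    widen (m≤m⊔n (deg p) (deg q)) (m≤m⊔n (dep p) (dep q)) (steps-≤ p ρ okp) ⊕
    const≤ 4 _ _ ⊕
    widen (m≤n⊔m (deg p) (deg q)) (m≤n⊔m (dep p) (dep q)) (steps-≤ q _ okq) ⊕
    const≤ 3 _ _
  steps-≤ (cond e p q) ρ (okp , okq) =
    const≤ (suc (cost (translate e))) _ _ ⊕
    select-≤ (eval e ρ)
      (widen (m≤m⊔n (deg p) (deg q)) (m≤m⊔n (dep p) (dep q)) (steps-≤ p ρ okp))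
      (widen (m≤n⊔m (deg p) (deg q)) (m≤n⊔m (dep p) (dep q)) (steps-≤ q ρ okq))
  steps-≤ (fold s e p) ρ (oks , okf) =
    const≤ (suc (suc (cost (translateSrc s) + suc (cost (translate e) + 1)))) _ _ ⊕
    (lower (foldSteps-≤ _ _ _ (coef p * P (deg p) (dep p))
        (λ l a ok → unbound (steps-≤ p (l ∷ a ∷ ρ) ok)) (source s ρ) (eval e ρ) okf)
      (bound body ⊕ const≤ 3 _ _)) ⊕
    const≤ 8 _ _
    where
    k = 3 + (coef p + suc (cost advance))
    sp = spine (source s ρ)
    inner : Bound (3 + (coef p * P (deg p) (dep p) + suc (cost advance))) k (deg p) (dep p)
    inner = const≤ 3 _ _ ⊕ bound (≤-refl {coef p * P (deg p) (dep p)}) ⊕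
            const≤ (suc (cost advance)) _ _
    body : sp * (3 + (coef p * P (deg p) (dep p) + suc (cost advance))) ≤
           k * P (srcDeg s + deg p) (srcDep s + dep p)
    body = begin
      sp * (3 + (coef p * P (deg p) (dep p) + suc (cost advance)))
        ≤⟨ *-monoʳ-≤ sp (unbound inner) ⟩
      sp * (k * P (deg p) (dep p))   ≡⟨ *-assoc sp k (P (deg p) (dep p)) ⟨
      (sp * k) * P (deg p) (dep p)   ≡⟨ cong (_* P (deg p) (dep p)) (*-comm sp k) ⟩
      (k * sp) * P (deg p) (dep p)   ≡⟨ *-assoc k sp (P (deg p) (dep p)) ⟩
      k * (sp * P (deg p) (dep p))   ≤⟨ *-monoʳ-≤ k (source-spine s ρ oks (deg p) (dep p)) ⟩
      k * P (srcDeg s + deg p) (srcDep s + dep p) ∎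
      where open ≤-Reasoning
  steps-≤ (call {k = k} p es) ρ ok =
    const≤ (suc (cost (pushes es))) _ _ ⊕
    steps-≤ p (evals es ρ) ok ⊕
    const≤ (suc (cost (pops k (var 1F)))) _ _

-- Exchanging vertices of connected dominating sets

insert remove : ∀ {n} → Fin n → Subset n → Subset n
insert i D = D [ i ]≔ true
remove i D = D [ i ]≔ false

insertAll : ∀ {n} → List (Fin n) → Subset n → Subset n
insertAll []       D = D
insertAll (x ∷ xs) D = insertAll xs (insert x D)

insertAll-++ : ∀ {n} (xs ys : List (Fin n)) D → insertAll (xs ++ ys) D ≡ insertAll ys (insertAll xs D)
insertAll-++ []       ys D = refl
insertAll-++ (x ∷ xs) ys D = insertAll-++ xs ys (insert x D)

module _ {n : ℕ} where

  ∈-insert : ∀ (i : Fin n) D → i ∈ insert i D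
  ∈-insert i D = []≔-updates D i

  ∈-update : ∀ {x i : Fin n} {b} D → x ≢ i → x ∈ D → x ∈ D [ i ]≔ b
  ∈-update D x≢i x∈ = []≔-minimal D _ _ x≢i x∈

  ⊆-insert : ∀ (i : Fin n) D → D ⊆ insert i D
  ⊆-insert i D {x} x∈ with x ≟ i
  ... | yes refl = ∈-insert i D
  ... | no x≢i   = ∈-update D x≢i x∈

  ∈-update⁻ : ∀ {x i : Fin n} {b} D → x ≢ i → x ∈ D [ i ]≔ b → x ∈ D
  ∈-update⁻ {x} {i} D x≢i x∈ =
    lookup⇒[]= x D (trans (sym (lookup∘updateAt′ x i x≢i D)) ([]=⇒lookup x∈))

  ∉-remove : ∀ (i : Fin n) D → i ∉ remove i D
  ∉-remove i D i∈ with trans (sym ([]=⇒lookup i∈)) (lookup∘updateAt i D)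
  ... | ()

  ∈-remove⁻ : ∀ {x i : Fin n} D → x ∈ remove i D → x ≢ i × x ∈ D
  ∈-remove⁻ {x} {i} D x∈ = x≢i , ∈-update⁻ D x≢i x∈
    where
    x≢i : x ≢ i
    x≢i refl = ∉-remove i D x∈

  remove-⊆ : ∀ (i : Fin n) D → remove i D ⊆ D
  remove-⊆ i D x∈ = proj₂ (∈-remove⁻ D x∈)

  remove-mono : ∀ (i : Fin n) {D E} → D ⊆ E → remove i D ⊆ remove i E
  remove-mono i {D} {E} D⊆E x∈ =
    ∈-update E (proj₁ (∈-remove⁻ D x∈)) (D⊆E (proj₂ (∈-remove⁻ D x∈)))

  ∈-insert⁻ : ∀ {x i : Fin n} D → x ∈ insert i D → x ≡ i ⊎ x ∈ D
  ∈-insert⁻ {x} {i} D x∈ with x ≟ i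
  ... | yes eq = inj₁ eq
  ... | no x≢i = inj₂ (∈-update⁻ D x≢i x∈)

  ⊆-insertAll : ∀ (xs : List (Fin n)) D → D ⊆ insertAll xs D
  ⊆-insertAll []       D x∈ = x∈
  ⊆-insertAll (x ∷ xs) D y∈ = ⊆-insertAll xs (insert x D) (⊆-insert x D y∈)

  ∈-insertAll : ∀ {x} {xs : List (Fin n)} D → x ∈ˡ xs → x ∈ insertAll xs D
  ∈-insertAll {xs = x ∷ xs} D (here refl) = ⊆-insertAll xs _ (∈-insert x D)
  ∈-insertAll {xs = y ∷ xs} D (there x∈)  = ∈-insertAll (insert y D) x∈

  ∈-insertAll⁻ : ∀ {x} (xs : List (Fin n)) D → x ∈ insertAll xs D → x ∈ˡ xs ⊎ x ∈ D
  ∈-insertAll⁻ []       D x∈ = inj₂ x∈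
  ∈-insertAll⁻ (y ∷ xs) D x∈ with ∈-insertAll⁻ xs (insert y D) x∈
  ... | inj₁ x∈xs = inj₁ (there x∈xs)
  ... | inj₂ x∈D with ∈-insert⁻ D x∈D
  ...   | inj₁ refl = inj₁ (here refl)
  ...   | inj₂ x∈D  = inj₂ x∈D

⊆-or-witness : ∀ {n} (D E : Subset n) → D ⊆ E ⊎ (∃[ x ] x ∈ D × x ∉ E)
⊆-or-witness D E with nonempty? (D ∩ ∁ E)
... | yes (x , x∈) = inj₂ (x , proj₁ (x∈p∩q⁻ D (∁ E) x∈) , x∈∁p⇒x∉p (proj₂ (x∈p∩q⁻ D (∁ E) x∈)))
... | no empty = inj₁ D⊆E
  where
  D⊆E : D ⊆ E
  D⊆E {x} x∈ with x ∈? E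
  ... | yes x∈E = x∈E
  ... | no x∉E  = contradiction (x , x∈p∩q⁺ (x∈ , x∉p⇒x∈∁p x∉E)) empty

elements : ∀ {n} → Subset n → List (Fin n)
elements []          = []
elements (true ∷ p)  = zero ∷ map suc (elements p)
elements (false ∷ p) = map suc (elements p)

length-elements : ∀ {n} (p : Subset n) → length (elements p) ≡ ∣ p ∣
length-elements []          = refl
length-elements (true ∷ p)  = cong suc (trans (length-map suc (elements p)) (length-elements p))
length-elements (false ∷ p) = trans (length-map suc (elements p)) (length-elements p)

∈-elements : ∀ {n} {x : Fin n} {p} → x ∈ p → x ∈ˡ elements p
∈-elements {p = _ ∷ _}     here       = here refl
∈-elements {p = true ∷ p}  (there x∈) = there (∈-map⁺ suc (∈-elements x∈))
∈-elements {p = false ∷ p} (there x∈) = ∈-map⁺ suc (∈-elements x∈)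

∈-elements⁻ : ∀ {n} {x : Fin n} p → x ∈ˡ elements p → x ∈ p
∈-elements⁻ (true ∷ p) (here refl) = here
∈-elements⁻ (true ∷ p) (there x∈) with ∈-map⁻ suc x∈
... | y , y∈ , refl = there (∈-elements⁻ p y∈)
∈-elements⁻ (false ∷ p) x∈ with ∈-map⁻ suc x∈
... | y , y∈ , refl = there (∈-elements⁻ p y∈)

-- Covering sets, walks and the exchange step

module _ {n : ℕ} (G : Graph n) where

  Adj-sym : ∀ {u v} → Adj G u v → Adj G v u
  Adj-sym {u} {v} a = trans (adj-sym G v u) a

  ∈-neighbours : ∀ {u v} → Adj G u v → v ∈ neighbours G u
  ∈-neighbours {u} {v} a = lookup⇒[]= v _ (trans (lookup∘tabulate (adj G u) v) a)

  ∈-neighbours⁻ : ∀ {u v} → v ∈ neighbours G u → Adj G u v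
  ∈-neighbours⁻ {u} {v} v∈ = trans (sym (lookup∘tabulate (adj G u) v)) ([]=⇒lookup v∈)

  Walk : Subset n → Fin n → Fin n → Set
  Walk S = Star (AdjIn G S)

  Walk-mono : ∀ {S T u v} → S ⊆ T → Walk S u v → Walk T u v
  Walk-mono S⊆T = Star.map λ (u∈ , v∈ , a) → S⊆T u∈ , S⊆T v∈ , a

  Walk-sym : ∀ {S u v} → Walk S u v → Walk S v u
  Walk-sym = Star.reverse λ (u∈ , v∈ , a) → v∈ , u∈ , Adj-sym a

  Near : Fin n → Fin n → Set
  Near u v = u ≡ v ⊎ Adj G u v

  Near⇒Walk : ∀ {S u v} → u ∈ S → v ∈ S → Near u v → Walk S u v
  Near⇒Walk u∈ v∈ (inj₁ refl) = ε
  Near⇒Walk u∈ v∈ (inj₂ a)    = (u∈ , v∈ , a) ◅ ε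

  Near-sym : ∀ {u v} → Near u v → Near v u
  Near-sym (inj₁ eq) = inj₁ (sym eq)
  Near-sym (inj₂ a)  = inj₂ (Adj-sym a)

  Covering : Subset n → Set
  Covering S = ∀ v → ∃[ s ] s ∈ S × Near s v

  Dominating⇒Covering : ∀ {S} → Dominating G S → Covering S
  Dominating⇒Covering {S} dom v with v ∈? S
  ... | yes v∈ = v , v∈ , inj₁ refl
  ... | no v∉ with dom v v∉
  ...   | u , u∈ , a = u , u∈ , inj₂ (Adj-sym a)

  Covering⇒Dominating : ∀ {S} → Covering S → Dominating G S
  Covering⇒Dominating cov v v∉ with cov v
  ... | s , s∈ , inj₁ refl = contradiction s∈ v∉
  ... | s , s∈ , inj₂ a    = s , s∈ , Adj-sym a

  Covering-mono : ∀ {S T} → S ⊆ T → Covering S → Covering T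
  Covering-mono S⊆T cov v with cov v
  ... | s , s∈ , near = s , S⊆T s∈ , near

  -- Every vertex of T lies in S or next to it, so it reaches S within T in at most one step and
  -- travels on inside S.
  CD-mono : ∀ {S T} → S ⊆ T → ConnectedDominating G S → ConnectedDominating G T
  CD-mono {S} {T} S⊆T (dom , (x , x∈) , conn) =
    Covering⇒Dominating (Covering-mono S⊆T cov) , (x , S⊆T x∈) , λ u∈ v∈ →
      let s , s∈ , us = anchor u∈
          t , t∈ , vt = anchor v∈
      in us ◅◅ Walk-mono S⊆T (conn s∈ t∈) ◅◅ Walk-sym vt
    where
    cov = Dominating⇒Covering dom
    anchor : ∀ {u} → u ∈ T → ∃[ s ] s ∈ S × Walk T u s
    anchor {u} u∈ with cov u
    ... | s , s∈ , near = s , s∈ , Near⇒Walk u∈ (S⊆T s∈) (Near-sym near)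

  -- A connected dominating proper subset misses some i of D; by monotonicity `remove i D` would
  -- then be connected dominating too.
  minimal : ∀ {D} → ConnectedDominating G D →
    (∀ i → i ∈ D → ¬ ConnectedDominating G (remove i D)) → MinimalConnectedDominating G D
  minimal {D} cd irr = cd , λ E (E⊆D , i , i∈D , i∉E) cdE →
    irr i i∈D (CD-mono (λ x∈ → ∈-update D (λ { refl → i∉E x∈ }) (E⊆D x∈)) cdE)

  minimal-⊆ : ∀ {D E} → MinimalConnectedDominating G D → MinimalConnectedDominating G E →
    D ⊆ E → D ≡ E
  minimal-⊆ {D} {E} (cdD , _) (_ , minE) D⊆E = ⊆-antisym D⊆E E⊆D
    where
    E⊆D : E ⊆ D
    E⊆D with ⊆-or-witness E D
    ... | inj₁ sub = sub
    ... | inj₂ (x , x∈ , x∉) = contradiction cdD (minE D (D⊆E , x , x∈ , x∉))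

  -- Components are never computed. A list meeting all of them stands in for them; it may meet one
  -- component several times, so only its length matters.
  Represents : Subset n → List (Fin n) → Set
  Represents S R = ∀ {u} → u ∈ S → ∃[ r ] r ∈ˡ R × Walk S u r

  -- Follow a walk of T from r to r′, keeping beside the current vertex some c of S in the component
  -- of r. At the first step to a vertex covered from S by one with a different representative, the
  -- two ends of that step bridge the gap and make r redundant.
  merge : ∀ {S T r r′ R} → S ⊆ T → Covering S → ConnectedOn G T →
    r ∈ S → r′ ∈ S → Represents S (r ∷ r′ ∷ R) →
    ∃[ p ] ∃[ q ] p ∈ T × q ∈ T × Represents (insert q (insert p S)) (r′ ∷ R)
  merge {S} {T} {r} {r′} {R} S⊆T cov (_ , conn) r∈ r′∈ rep =
    let p , q , p∈ , q∈ , br = walk (S⊆T r∈) r r∈ ε (inj₁ refl) (conn (S⊆T r∈) (S⊆T r′∈))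
    in p , q , p∈ , q∈ , conclude br
    where
    -- c lies in the component of r, s in another one, and c – p – q – s is a walk.
    Bridge : Fin n → Fin n → Set
    Bridge p q = ∃[ c ] ∃[ s ] ∃[ t ] c ∈ S × Walk S c r × s ∈ S × Walk S s t ×
      t ∈ˡ r′ ∷ R × Near c p × Near p q × Near q s

    walk : ∀ {p} → p ∈ T → ∀ c → c ∈ S → Walk S c r → Near c p → Walk T p r′ →
      ∃[ p ] ∃[ q ] p ∈ T × q ∈ T × Bridge p q
    -- The walk has arrived at r′, itself in S: p = q = s = r′ is a degenerate bridge.
    walk {p} p∈ c c∈ cr cp ε =
      p , p , p∈ , p∈ , c , p , p , c∈ , cr , r′∈ , ε , here refl , cp , inj₁ refl , inj₁ refl
    walk {p} p∈ c c∈ cr cp (_◅_ {j = q} (_ , q∈ , pq) rest) with cov q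
    ... | s , s∈ , sq with rep s∈
    -- s is still represented by r and takes over the role of c.
    ...   | t , here refl , sr = walk q∈ s s∈ sr sq rest
    ...   | t , there t∈  , st =
      p , q , p∈ , q∈ , c , s , t , c∈ , cr , s∈ , st , t∈ , cp , inj₂ pq , Near-sym sq

    conclude : ∀ {p q} → Bridge p q → Represents (insert q (insert p S)) (r′ ∷ R)
    conclude {p} {q} (c , s , t , c∈ , cr , s∈ , st , t∈ , cp , pq , qs) {u} u∈
      with ∈-insert⁻ (insert p S) u∈
    ... | inj₁ refl = t , t∈ , qt
      where
      S⊆ : S ⊆ insert q (insert p S)
      S⊆ = ⊆-insert q _ ∘ ⊆-insert p S
      qt = Near⇒Walk (∈-insert q _) (S⊆ s∈) qs ◅◅ Walk-mono S⊆ st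
    ... | inj₂ u∈′ = other (∈-insert⁻ S u∈′)
      where
      S′ = insert q (insert p S)
      S⊆ : S ⊆ S′
      S⊆ = ⊆-insert q _ ∘ ⊆-insert p S
      p∈ : p ∈ S′
      p∈ = ⊆-insert q _ (∈-insert p S)
      pt : Walk S′ p t
      pt = Near⇒Walk p∈ (∈-insert q _) pq ◅◅ Near⇒Walk (∈-insert q _) (S⊆ s∈) qs
           ◅◅ Walk-mono S⊆ st
      other : u ≡ p ⊎ u ∈ S → ∃[ r ] r ∈ˡ r′ ∷ R × Walk S′ u r
      other (inj₁ refl) = t , t∈ , pt
      other (inj₂ u∈S) with rep u∈S
      ... | _ , there x∈ , ux = _ , x∈ , Walk-mono S⊆ ux
      ... | _ , here refl , ur = t , t∈ ,
        Walk-mono S⊆ (ur ◅◅ Walk-sym cr) ◅◅ Near⇒Walk (S⊆ c∈) p∈ cp ◅◅ pt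

  -- Each merger removes one representative at the price of two vertices; a covering set with a
  -- single representative is connected.
  mergeAll : ∀ {S T} r R → S ⊆ T → Covering S → ConnectedOn G T → All (_∈ S) (r ∷ R) →
    Represents S (r ∷ R) →
    ∃[ X ] length X ≡ length R * 2 × All (_∈ T) X × ConnectedDominating G (insertAll X S)
  mergeAll {S} r [] S⊆T cov conn (r∈ ∷ []) rep =
    [] , refl , [] , Covering⇒Dominating cov , (r , r∈) , λ u∈ v∈ → toRep u∈ ◅◅ Walk-sym (toRep v∈)
    where
    toRep : ∀ {u} → u ∈ S → Walk S u r
    toRep u∈ with rep u∈
    ... | _ , here refl , w = w
  mergeAll {S} {T} r (r′ ∷ R) S⊆T cov conn (r∈ ∷ r′∈ ∷ R∈) rep
    with merge S⊆T cov conn r∈ r′∈ rep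
  ... | p , q , p∈ , q∈ , rep′
    with mergeAll {T = T} r′ R sub (Covering-mono S⊆ cov) conn (All.map S⊆ (r′∈ ∷ R∈)) rep′
    where
    S⊆ : S ⊆ insert q (insert p S)
    S⊆ = ⊆-insert q _ ∘ ⊆-insert p S
    sub : insert q (insert p S) ⊆ T
    sub x∈ with ∈-insert⁻ (insert p S) x∈
    ... | inj₁ refl = q∈
    ... | inj₂ x∈′ with ∈-insert⁻ S x∈′
    ...   | inj₁ refl = p∈
    ...   | inj₂ x∈S  = S⊆T x∈S
  ... | X , len , X∈ , cd = p ∷ q ∷ X , cong (2 +_) len , p∈ ∷ q∈ ∷ X∈ , cd

  -- The walk from u to v is cut just before it first reaches v.
  lastBefore : ∀ {D u v} → u ≢ v → Walk D u v →
    ∃[ w ] w ∈ D × w ≢ v × Adj G w v × Walk (remove v D) u w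
  lastBefore u≢v ε = contradiction refl u≢v
  lastBefore {D} {u} {v} u≢v (_◅_ {j = w} (u∈ , w∈ , uw) rest) with w ≟ v
  ... | yes refl = u , u∈ , u≢v , uw , ε
  ... | no w≢v with lastBefore w≢v rest
  ...   | x , x∈ , x≢v , xv , wx =
    x , x∈ , x≢v , xv , (∈-update D u≢v u∈ , ∈-update D w≢v w∈ , uw) ◅ wx

  module _ {D E : Subset n} (cdD : ConnectedDominating G D) (cdE : ConnectedDominating G E)
           {v : Fin n} (v∈D : v ∈ D) (v∉E : v ∉ E) where

    private
      T = remove v D ∪ E

      E⊆T : E ⊆ T
      E⊆T x∈ = x∈p∪q⁺ (inj₂ x∈)

      D-v⊆T : remove v D ⊆ T
      D-v⊆T x∈ = x∈p∪q⁺ {p = remove v D} (inj₁ x∈)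

      -- A vertex of T stands for itself, any other is covered from E. The last clause keeps the
      -- neighbours of v in D as representatives of their components.
      choose : ∀ w → ∃[ x ] x ∈ T × Near x w × (w ∈ T → x ≡ w)
      choose w with w ∈? T
      ... | yes w∈ = w , w∈ , inj₁ refl , λ _ → refl
      ... | no w∉ with proj₁ cdE w (w∉ ∘ E⊆T)
      ...   | x , x∈ , wx = x , E⊆T x∈ , inj₂ (Adj-sym wx) , λ w∈ → contradiction w∈ w∉

      rep : Fin n → Fin n
      rep w = proj₁ (choose w)

      Nb R : List (Fin n)
      Nb = elements (neighbours G v)
      R  = map rep Nb

      S₀ : Subset n
      S₀ = insertAll R (remove v D)

      rep∈R : ∀ {w} → Adj G v w → rep w ∈ˡ R
      rep∈R vw = ∈-map⁺ rep (∈-elements (∈-neighbours vw))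

      rep∈S₀ : ∀ {w} → Adj G v w → rep w ∈ S₀
      rep∈S₀ vw = ∈-insertAll (remove v D) (rep∈R vw)

      near-rep : ∀ w → Near (rep w) w
      near-rep w = proj₁ (proj₂ (proj₂ (choose w)))

      rep-fixed : ∀ {w} → w ∈ T → rep w ≡ w
      rep-fixed {w} = proj₂ (proj₂ (proj₂ (choose w)))

      D-v⊆S₀ : remove v D ⊆ S₀
      D-v⊆S₀ = ⊆-insertAll R (remove v D)

      R⊆T : All (_∈ T) R
      R⊆T = map⁺ (All.universal (λ w → proj₁ (proj₂ (choose w))) Nb)

      S₀⊆T : S₀ ⊆ T
      S₀⊆T x∈ with ∈-insertAll⁻ R (remove v D) x∈
      ... | inj₁ x∈R = All.lookup R⊆T x∈R
      ... | inj₂ x∈D = D-v⊆T x∈D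

      cov : Covering S₀
      cov y with y ≟ v
      -- v has left the set and needs a dominator itself: one in E is a neighbour of v that lies in
      -- T, hence its own choice.
      ... | yes refl with proj₁ cdE v v∉E
      ...   | w , w∈ , vw =
        w , subst (_∈ S₀) (rep-fixed (E⊆T w∈)) (rep∈S₀ vw) , inj₂ (Adj-sym vw)
      cov y | no y≢v with Dominating⇒Covering (proj₁ cdD) y
      ...   | u , u∈ , near with u ≟ v
      ...     | no u≢v = u , D-v⊆S₀ (∈-update D u≢v u∈) , near
      cov y | no y≢v | u , u∈ , inj₁ refl | yes refl = contradiction refl y≢v
      -- The dominator supplied by D was v, so y is a neighbour of v and its chosen vertex has been
      -- inserted.
      cov y | no y≢v | u , u∈ , inj₂ vy   | yes refl = rep y , rep∈S₀ vy , near-rep y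

      represents : Represents S₀ R
      represents {u} u∈ with ∈-insertAll⁻ R (remove v D) u∈
      ... | inj₁ u∈R = u , u∈R , ε
      ... | inj₂ u∈D-v with ∈-remove⁻ D u∈D-v
      ...   | u≢v , u∈D with lastBefore u≢v (proj₂ (proj₂ cdD) u∈D v∈D)
      ...     | w , w∈ , w≢v , wv , uw =
        w , subst (_∈ˡ R) (rep-fixed (D-v⊆T (∈-update D w≢v w∈))) (rep∈R (Adj-sym wv)) ,
        Walk-mono D-v⊆S₀ uw

      lengthR : length R ≡ degree G v
      lengthR = trans (length-map rep Nb) (length-elements (neighbours G v))

      R⊆S₀ : All (_∈ S₀) R
      R⊆S₀ = All.tabulate (∈-insertAll (remove v D))

    exchange : ∃[ X ] length X ≡ 3 * degree G v × (∀ {x} → x ∈ˡ X → x ∈ T) ×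
               ConnectedDominating G (insertAll X (remove v D))
    exchange = go R refl R⊆T R⊆S₀ represents
      where
      go : ∀ Q → Q ≡ R → All (_∈ T) Q → All (_∈ S₀) Q → Represents S₀ Q →
           ∃[ X ] length X ≡ 3 * degree G v × (∀ {x} → x ∈ˡ X → x ∈ T) ×
           ConnectedDominating G (insertAll X (remove v D))
      -- R is not empty: some vertex of S₀ covers v, and it has a representative in R.
      go [] _ _ _ reps with cov v
      ... | s , s∈ , _ with reps s∈
      ...   | _ , () , _
      go (r ∷ Q) eq (r∈T ∷ Q∈T) Q∈S reps
        with mergeAll r Q S₀⊆T cov (proj₂ (CD-mono E⊆T cdE)) Q∈S reps
      ... | X , len , X∈ , cd = R ++ (X ++ pad) , total , All.lookup (++⁺ R⊆T (++⁺ X∈ (replicate⁺ 2 r∈T))) ,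
        subst (ConnectedDominating G) (sym split) (CD-mono (⊆-insertAll pad _) cd)
        where
        -- deg v entries of R and 2 (deg v - 1) bridging vertices leave two insertions to fill.
        pad = replicate 2 r
        split : insertAll (R ++ (X ++ pad)) (remove v D) ≡ insertAll pad (insertAll X S₀)
        split = trans (insertAll-++ R (X ++ pad) (remove v D)) (insertAll-++ X pad S₀)
        d≡ : suc (length Q) ≡ degree G v
        d≡ = trans (cong length eq) lengthR
        total : length (R ++ (X ++ pad)) ≡ 3 * degree G v
        total = begin
          length (R ++ (X ++ pad))          ≡⟨ length-++ R ⟩
          length R + length (X ++ pad)      ≡⟨ cong₂ _+_ lengthR (length-++ X) ⟩
          degree G v + (length X + 2)       ≡⟨ cong (λ t → degree G v + (t + 2)) len ⟩
          degree G v + (length Q * 2 + 2)   ≡⟨ cong (degree G v +_) (+-comm (length Q * 2) 2) ⟩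
          degree G v + suc (length Q) * 2   ≡⟨ cong (λ t → degree G v + t * 2) d≡ ⟩
          degree G v + degree G v * 2       ≡⟨ cong (degree G v +_) (*-comm (degree G v) 2) ⟩
          3 * degree G v ∎
          where open ≡-Reasoning

    -- Outside E, T contains only vertices of D different from v. So M has no new vertices outside
    -- E, and v is gone.
    exchange-closer : ∀ {X M} → (∀ {x} → x ∈ˡ X → x ∈ T) → M ⊆ insertAll X (remove v D) →
      ∣ M ∩ ∁ E ∣ < ∣ D ∩ ∁ E ∣
    exchange-closer {X} {M} X⊆T M⊆ = p⊂q⇒∣p∣<∣q∣
      ( (λ x∈ → let x∈M , x∈∁E = x∈p∩q⁻ M (∁ E) x∈
                    x∉E = x∈∁p⇒x∉p x∈∁E
                in x∈p∩q⁺ (proj₂ (∈-remove⁻ D (fromT x∉E (candidate (M⊆ x∈M)))) , x∈∁E))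
      , v , x∈p∩q⁺ (v∈D , x∉p⇒x∈∁p v∉E)
      , λ v∈ → ∉-remove v D (fromT v∉E (candidate (M⊆ (proj₁ (x∈p∩q⁻ M (∁ E) v∈))))) )
      where
      candidate : ∀ {x} → x ∈ insertAll X (remove v D) → x ∈ T
      candidate x∈ with ∈-insertAll⁻ X (remove v D) x∈
      ... | inj₁ x∈X = X⊆T x∈X
      ... | inj₂ x∈D = D-v⊆T x∈D
      fromT : ∀ {x} → x ∉ E → x ∈ T → x ∈ remove v D
      fromT x∉E x∈T with x∈p∪q⁻ (remove v D) E x∈T
      ... | inj₁ x∈D = x∈D
      ... | inj₂ x∈E = contradiction x∈E x∉E

  -- Which solution inside the modified set has been listed is left open: the descent towards
  -- another solution uses the inclusion alone.
  Expanded : List (Subset n) → Subset n → Set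
  Expanded Ds D = ∀ v → v ∈ D → ∀ X → length X ≡ 3 * degree G v →
    ConnectedDominating G (insertAll X (remove v D)) →
    ∃[ M ] M ∈ˡ Ds × M ⊆ insertAll X (remove v D)

  Closed : List (Subset n) → Set
  Closed Ds = ∀ {D} → D ∈ˡ Ds → Expanded Ds D

  -- Induction on a bound k for the number of vertices of D outside E, which every exchange
  -- decreases. When none is left, D ⊆ E and minimality forces equality.
  closed⇒all : ∀ {Ds D} → (∀ {D} → D ∈ˡ Ds → MinimalConnectedDominating G D) → Closed Ds →
    D ∈ˡ Ds → ∀ {E} → MinimalConnectedDominating G E → E ∈ˡ Ds
  closed⇒all {Ds} {D₀} sound closed D₀∈ {E} mE = go _ D₀∈ ≤-refl
    where
    go : ∀ k {D} → D ∈ˡ Ds → ∣ D ∩ ∁ E ∣ ≤ k → E ∈ˡ Ds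
    go k {D} D∈ le with ⊆-or-witness D E
    ... | inj₁ D⊆E = subst (_∈ˡ Ds) (minimal-⊆ (sound D∈) mE D⊆E) D∈
    ... | inj₂ (v , v∈D , v∉E) with exchange (proj₁ (sound D∈)) (proj₁ mE) v∈D v∉E
    ...   | X , len , X⊆T , cd with closed D∈ v v∈D X len cd
    ...     | M , M∈ , M⊆ = step k le (exchange-closer (proj₁ (sound D∈)) (proj₁ mE) v∈D v∉E X⊆T M⊆)
      where
      step : ∀ k → ∣ D ∩ ∁ E ∣ ≤ k → ∣ M ∩ ∁ E ∣ < ∣ D ∩ ∁ E ∣ → E ∈ˡ Ds
      step zero    le lt = contradiction (<-≤-trans lt le) n≮0
      step (suc k) le lt = go k M∈ (≤-pred (<-≤-trans lt le))

-- Deciding connected domination and minimising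

v0 : ∀ {m} → Expr (1 + m)
v0 = var zero
v1 : ∀ {m} → Expr (2 + m)
v1 = var (suc zero)
v2 : ∀ {m} → Expr (3 + m)
v2 = var (suc (suc zero))
v3 : ∀ {m} → Expr (4 + m)
v3 = var (suc (suc (suc zero)))
v4 : ∀ {m} → Expr (5 + m)
v4 = var (suc (suc (suc (suc zero))))
v5 : ∀ {m} → Expr (6 + m)
v5 = var (suc (suc (suc (suc (suc zero)))))
v6 : ∀ {m} → Expr (7 + m)
v6 = var (suc (suc (suc (suc (suc (suc zero))))))
v7 : ∀ {m} → Expr (8 + m)
v7 = var (suc (suc (suc (suc (suc (suc (suc zero)))))))

yes′ : ∀ {m} → Expr m
yes′ = `cons `nil `nil

-- Truth has one fixed form, the tree of the bit `true`, so an answer can be consed directly into an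
-- encoded set.
data Decides (P : Set) : Tree → Set where
  holds : P → Decides P (cons nil nil)
  fails : ¬ P → Decides P nil

module _ {P Q : Set} where

  decides-map : ∀ {t} → (P → Q) → (Q → P) → Decides P t → Decides Q t
  decides-map f g (holds p) = holds (f p)
  decides-map f g (fails ¬p) = fails (¬p ∘ g)

  decides-× : ∀ {x y} → Decides P x → (P → Decides Q y) → Decides (P × Q) (select x y nil)
  decides-× (fails ¬p) d = fails (¬p ∘ proj₁)
  decides-× (holds p) d with d p
  ... | holds q  = holds (p , q)
  ... | fails ¬q = fails (¬q ∘ proj₂)

  decides-⊎ : ∀ {x y} → Decides P x → Decides Q y → Decides (P ⊎ Q) (select x (cons nil nil) y)
  decides-⊎ (holds p) d = holds (inj₁ p)
  decides-⊎ (fails ¬p) (holds q)  = holds (inj₂ q)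
  decides-⊎ (fails ¬p) (fails ¬q) = fails [ ¬p , ¬q ]′

  decides-→ : ∀ {x y} → Decides P x → (P → Decides Q y) →
              Decides (P → Q) (select x y (cons nil nil))
  decides-→ (fails ¬p) d = holds λ p → contradiction p ¬p
  decides-→ (holds p) d with d p
  ... | holds q  = holds λ _ → q
  ... | fails ¬q = fails λ f → ¬q (f p)

decides-bool : ∀ {P : Set} b → (b ≡ true → P) → (P → b ≡ true) → Decides P (encodeBool b)
decides-bool true  f g = holds (f refl)
decides-bool false f g = fails λ p → contradiction (g p) λ ()

tails : ℕ → Tree → Tree
tails zero    t = t
tails (suc k) t = tails k (tl t)

tails-num : ∀ j i → tails j (num i) ≡ num (i ∸ j)
tails-num zero    i       = refl
tails-num (suc j) zero    = tails-nil j
  where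
  tails-nil : ∀ j → tails j nil ≡ nil
  tails-nil zero    = refl
  tails-nil (suc j) = tails-nil j
tails-num (suc j) (suc i) = tails-num j i

tab : ∀ {n} → (Fin n → Tree) → Tree
tab {zero}  f = nil
tab {suc n} f = cons (f zero) (tab (f ∘ suc))

tails-tab : ∀ {n} (f : Fin n → Tree) i →
            tails (toℕ i) (tab f) ≡ cons (f i) (tails (suc (toℕ i)) (tab f))
tails-tab f zero    = refl
tails-tab f (suc i) = tails-tab (f ∘ suc) i

tails-tab-end : ∀ {n} (f : Fin n → Tree) → tails n (tab f) ≡ nil
tails-tab-end {zero}  f = refl
tails-tab-end {suc n} f = tails-tab-end (f ∘ suc)

encodeSubset-tab : ∀ {n} (D : Subset n) → encodeSubset D ≡ tab (encodeBool ∘ lookup D)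
encodeSubset-tab []      = refl
encodeSubset-tab (b ∷ D) = cong (cons (encodeBool b)) (encodeSubset-tab D)

encodeList-tab : ∀ {A : Set} {n} (e : A → Tree) (h : Fin n → A) →
                 encodeList e (List.tabulate h) ≡ tab (e ∘ h)
encodeList-tab {n = zero}  e h = refl
encodeList-tab {n = suc n} e h = cong (cons (e (h zero))) (encodeList-tab e (h ∘ suc))

-- `I k` is to hold once the indices from n - 1 down to k have been treated.
foldNum-inv : ∀ n (I : ℕ → Tree → Set) {g} →
  (∀ (i : Fin n) a → I (suc (toℕ i)) a → I (toℕ i) (g (num (suc (toℕ i))) a)) →
  ∀ {a} → I n a → I 0 (foldTree g (num n) a)
foldNum-inv n I {g} step = go n ≤-refl
  where
  go : ∀ k → k ≤ n → ∀ {a} → I k a → I 0 (foldTree g (num k) a)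
  go zero    k≤n     i = i
  go (suc k) k<n {a} i = go k (<⇒≤ k<n)
    (subst (λ j → I (suc j) a → I j (g (num (suc j)) a)) (toℕ-fromℕ< k<n)
      (step (fromℕ< k<n) a) i)

opaque
  dropCode : Code 2
  dropCode = bind
    (fold clock (`cons v0 v1)
      (cond (`tl v1) (ret (`cons (`tl (`hd v1)) (`tl (`tl v1)))) (ret v1)))
    (ret (`hd v0))

  lookupCode : Code 2
  lookupCode = bind (call dropCode (v0 ∷ v1 ∷ [])) (ret (`hd v0))

  equalCode : Code 2
  equalCode = bind (call dropCode (v0 ∷ v1 ∷ []))
    (bind (call dropCode (v2 ∷ v1 ∷ []))
      (cond v0 (ret `nil) (cond v1 (ret `nil) (ret yes′))))

  updateCode : Expr 5 → Code 2
  updateCode b = fold clock `nil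
    (bind (bind (call equalCode (`tl v0 ∷ v3 ∷ []))
                (cond v0 (ret b) (call lookupCode (v3 ∷ `tl v1 ∷ []))))
          (ret (`cons v0 v2)))

tabCode someCode everyCode : ∀ {m} → Code (2 + m) → Code m
tabCode   b = fold clock `nil (bind b (ret (`cons v0 v2)))
someCode  b = fold clock `nil (bind b (cond v0 (ret yes′) (ret v2)))
everyCode b = fold clock yes′ (bind b (cond v0 (ret v2) (ret `nil)))

opaque
  adjCode nearCode : Code 3
  adjCode  = bind (call lookupCode (v0 ∷ v1 ∷ [])) (call lookupCode (v0 ∷ v3 ∷ []))
  nearCode = bind (call equalCode (v1 ∷ v2 ∷ []))
    (cond v0 (ret yes′) (call adjCode (v1 ∷ v2 ∷ v3 ∷ [])))

  coverCode : Code 2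
  coverCode = everyCode (someCode
    (bind (call lookupCode (v5 ∷ `tl v0 ∷ []))
      (cond v0 (call nearCode (v5 ∷ `tl v1 ∷ `tl v3 ∷ [])) (ret `nil))))

  growCode : Code 3
  growCode = tabCode
    (bind (call lookupCode (v3 ∷ `tl v0 ∷ []))
      (cond v0
        (someCode (bind (call lookupCode (v7 ∷ `tl v0 ∷ []))
          (cond v0 (call nearCode (v6 ∷ `tl v1 ∷ `tl v4 ∷ [])) (ret `nil))))
        (ret `nil)))

  reachCode : Code 3
  reachCode = bind (tabCode (call equalCode (`tl v0 ∷ v4 ∷ [])))
    (fold clock v0 (call growCode (v3 ∷ v4 ∷ v1 ∷ [])))

  connectedCode : Code 2
  connectedCode = everyCode
    (bind (call lookupCode (v3 ∷ `tl v0 ∷ []))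
      (cond v0
        (bind (call reachCode (v3 ∷ v4 ∷ `tl v1 ∷ []))
          (everyCode
            (bind (call lookupCode (v7 ∷ `tl v0 ∷ []))
              (cond v0 (call lookupCode (v3 ∷ `tl v1 ∷ [])) (ret yes′)))))
        (ret yes′)))

  cdsCode : Code 2
  cdsCode = bind (call coverCode (v0 ∷ v1 ∷ []))
    (cond v0 (call connectedCode (v1 ∷ v2 ∷ [])) (ret `nil))

minimiseBody : Code 4
minimiseBody = bind (call (updateCode `nil) (v1 ∷ `tl v0 ∷ []))
  (bind (call cdsCode (v3 ∷ v0 ∷ [])) (cond v0 (ret v1) (ret v3)))

opaque
  minimiseCode : Code 2
  minimiseCode = fold clock v1 minimiseBody

-- Folds over the vertices and what they compute

module _ (n : ℕ) where
  open Semantics n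

  idx : Fin n → Tree
  idx i = num (toℕ i)

  opaque
    unfolding dropCode

    -- The clock lasts long enough for k rounds; once the counter is `nil`, the remaining rounds
    -- change nothing.
    drop-spec : ∀ k t → k ≤ n → ⟦ dropCode ⟧ (t ∷ num k ∷ []) ≡ tails k t
    drop-spec k t k≤n = cong hd (go n k t k≤n)
      where
      go : ∀ m k t → k ≤ m →
        foldTree (λ l a → select (tl a) (cons (tl (hd a)) (tl (tl a))) a) (num m) (cons t (num k))
          ≡ cons (tails k t) nil
      go zero    zero    t z≤n     = refl
      go (suc m) zero    t z≤n     = go m zero t z≤n
      go (suc m) (suc k) t (s≤s p) = go m k (tl t) p

  opaque
    unfolding lookupCode

    lookup-tab : ∀ (f : Fin n → Tree) i → ⟦ lookupCode ⟧ (tab f ∷ idx i ∷ []) ≡ f i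
    lookup-tab f i = cong hd (trans (drop-spec (toℕ i) (tab f) (<⇒≤ (toℕ<n i))) (tails-tab f i))

  lookup-subset : ∀ (D : Subset n) i →
                  ⟦ lookupCode ⟧ (encodeSubset D ∷ idx i ∷ []) ≡ encodeBool (lookup D i)
  lookup-subset D i =
    trans (cong (λ t → ⟦ lookupCode ⟧ (t ∷ idx i ∷ [])) (encodeSubset-tab D))
      (lookup-tab (encodeBool ∘ lookup D) i)

  member-spec : ∀ (D : Subset n) i → Decides (i ∈ D) (⟦ lookupCode ⟧ (encodeSubset D ∷ idx i ∷ []))
  member-spec D i = subst (Decides (i ∈ D)) (sym (lookup-subset D i))
    (decides-bool (lookup D i) (lookup⇒[]= i D) []=⇒lookup)

  opaque
    unfolding equalCode

    -- Trees can be tested only for `nil`, so equality is read off from i ∸ j and j ∸ i, both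
    -- obtained by dropping tails.
    equal-spec : ∀ (i j : Fin n) → Decides (i ≡ j) (⟦ equalCode ⟧ (idx i ∷ idx j ∷ []))
    equal-spec i j = subst₂ (λ x y → Decides (i ≡ j) (select y nil (select x nil (cons nil nil))))
      (sym (difference i j)) (sym (difference j i))
      (go (toℕ i ∸ toℕ j) (toℕ j ∸ toℕ i) refl refl)
      where
      difference : ∀ i j → ⟦ dropCode ⟧ (idx i ∷ idx j ∷ []) ≡ num (toℕ i ∸ toℕ j)
      difference i j = trans (drop-spec (toℕ j) (idx i) (<⇒≤ (toℕ<n j))) (tails-num (toℕ j) (toℕ i))
      go : ∀ x y → toℕ i ∸ toℕ j ≡ x → toℕ j ∸ toℕ i ≡ y →
           Decides (i ≡ j) (select (num y) nil (select (num x) nil (cons nil nil)))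
      go zero    zero    p q = holds (toℕ-injective (≤-antisym (m∸n≡0⇒m≤n p) (m∸n≡0⇒m≤n q)))
      go (suc x) zero    p q = fails λ { refl → 0≢1+n (trans (sym (n∸n≡0 (toℕ i))) p) }
      go x       (suc y) p q = fails λ { refl → 0≢1+n (trans (sym (n∸n≡0 (toℕ i))) q) }

  fold-tab : ∀ {f : Fin n → Tree} {h : Tree → Tree → Tree} →
    (∀ i a → h (num (suc (toℕ i))) a ≡ f i) →
    foldTree (λ l a → cons (h l a) a) (num n) nil ≡ tab f
  fold-tab {f} h≡f = foldNum-inv n (λ k a → a ≡ tails k (tab f))
    (λ i a eq → trans (cong₂ cons (h≡f i a) eq) (sym (tails-tab f i)))
    (sym (tails-tab-end f))

  data EncodesSet (P : Fin n → Set) : Tree → Set where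
    encodes : ∀ D → (∀ i → i ∈ D → P i) → (∀ i → P i → i ∈ D) → EncodesSet P (encodeSubset D)

  fold-set : ∀ {P : Fin n → Set} {h : Tree → Tree → Tree} →
    (∀ i a → Decides (P i) (h (num (suc (toℕ i))) a)) →
    EncodesSet P (foldTree (λ l a → cons (h l a) a) (num n) nil)
  fold-set {P} {h} dec =
    subst (EncodesSet P) (sym eq) (encodes D
      (λ i i∈ → proj₁ (proj₂ (value i nil)) (trans (sym (lookup∘tabulate _ i)) ([]=⇒lookup i∈)))
      (λ i p → lookup⇒[]= i D (trans (lookup∘tabulate _ i) (proj₁ (proj₂ (proj₂ (value i nil))) p))))
    where
    bit : ∀ {Q : Set} {t} → Decides Q t →
          ∃[ b ] (b ≡ true → Q) × (Q → b ≡ true) × t ≡ encodeBool b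
    bit (holds q)  = true , (λ _ → q) , (λ _ → refl) , refl
    bit (fails ¬q) = false , (λ ()) , (λ q → contradiction q ¬q) , refl
    value : ∀ i a → _
    value i a = bit (dec i a)
    D : Subset n
    D = Vec.tabulate λ i → proj₁ (value i nil)
    -- The computed bit may formally depend on the accumulator, but a decided proposition determines
    -- its tree, so the bits evaluated at `nil` are the right ones.
    unique : ∀ {Q : Set} {s t} → Decides Q s → Decides Q t → s ≡ t
    unique (holds _)  (holds _)  = refl
    unique (holds q)  (fails ¬q) = contradiction q ¬q
    unique (fails ¬q) (holds q)  = contradiction q ¬q
    unique (fails _)  (fails _)  = refl
    eq : foldTree (λ l a → cons (h l a) a) (num n) nil ≡ encodeSubset D
    eq = trans (fold-tab λ i a →
        trans (unique (dec i a) (dec i nil)) (trans (proj₂ (proj₂ (proj₂ (value i nil))))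
          (cong encodeBool (sym (lookup∘tabulate _ i)))))
      (sym (encodeSubset-tab D))

  split-≤ : ∀ {k} {i j : Fin n} → toℕ i ≡ k → k ≤ toℕ j → i ≡ j ⊎ suc k ≤ toℕ j
  split-≤ refl k≤j with m≤n⇒m<n∨m≡n k≤j
  ... | inj₁ lt = inj₂ lt
  ... | inj₂ eq = inj₁ (toℕ-injective eq)

  fold-some : ∀ {P : Fin n → Set} {h : Tree → Tree → Tree} →
    (∀ i a → Decides (P i) (h (num (suc (toℕ i))) a)) →
    Decides (∃ P) (foldTree (λ l a → select (h l a) (cons nil nil) a) (num n) nil)
  fold-some {P} dec = decides-map (λ (i , _ , p) → i , p) (λ (i , p) → i , z≤n , p)
    (foldNum-inv n (λ k a → Decides (∃[ i ] k ≤ toℕ i × P i) a)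
      (λ i a d → decides-map
        (λ { (inj₁ p) → i , ≤-refl , p ; (inj₂ (j , lt , p)) → j , <⇒≤ lt , p })
        (λ (j , le , p) → [ (λ { refl → inj₁ p }) , (λ lt → inj₂ (j , lt , p)) ]′ (split-≤ refl le))
        (decides-⊎ (dec i a) d))
      (fails λ (i , le , _) → <⇒≱ (toℕ<n i) le))

  fold-every : ∀ {P : Fin n → Set} {h : Tree → Tree → Tree} →
    (∀ i a → Decides (P i) (h (num (suc (toℕ i))) a)) →
    Decides (∀ i → P i) (foldTree (λ l a → select (h l a) a nil) (num n) (cons nil nil))
  fold-every {P} dec = decides-map (λ f i → f i z≤n) (λ f i _ → f i)
    (foldNum-inv n (λ k a → Decides (∀ i → k ≤ toℕ i → P i) a)
      (λ i a d → decides-map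
        (λ (p , f) j le → [ (λ { refl → p }) , f j ]′ (split-≤ refl le))
        (λ f → f i ≤-refl , λ j lt → f j (<⇒≤ lt))
        (decides-× (dec i a) λ _ → d))
      (holds λ i le → contradiction le (<⇒≱ (toℕ<n i))))

  opaque
    unfolding updateCode

    update-spec : ∀ e b → (∀ ρ → eval e ρ ≡ encodeBool b) → ∀ (D : Subset n) i →
      ⟦ updateCode e ⟧ (encodeSubset D ∷ idx i ∷ []) ≡ encodeSubset (D [ i ]≔ b)
    update-spec e b he D i = trans
      (fold-tab (λ j a → choose j (equal-spec j i) (he _)))
      (sym (encodeSubset-tab (D [ i ]≔ b)))
      where
      choose : ∀ j {t x} → Decides (j ≡ i) t → x ≡ encodeBool b →
        select t x (⟦ lookupCode ⟧ (encodeSubset D ∷ idx j ∷ []))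
          ≡ encodeBool (lookup (D [ i ]≔ b) j)
      choose j (holds refl) eq = trans eq (cong encodeBool (sym (lookup∘updateAt i D)))
      choose j (fails j≢i) eq  =
        trans (lookup-subset D j) (cong encodeBool (sym (lookup∘updateAt′ j i j≢i D)))

module _ {n : ℕ} (G : Graph n) where
  open Semantics n

  private
    g = encodeGraph G

  opaque
    unfolding adjCode

    adj-spec : ∀ u v → Decides (Adj G u v) (⟦ adjCode ⟧ (g ∷ idx n u ∷ idx n v ∷ []))
    adj-spec u v = decides-map (∈-neighbours⁻ G) (∈-neighbours G)
      (subst (λ t → Decides (v ∈ neighbours G u) (⟦ lookupCode ⟧ (t ∷ idx n v ∷ []))) (sym row)
        (member-spec n (neighbours G u) v))
      where
      row : ⟦ lookupCode ⟧ (g ∷ idx n u ∷ []) ≡ encodeSubset (neighbours G u)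
      row = trans (cong (λ t → ⟦ lookupCode ⟧ (t ∷ idx n u ∷ [])) (encodeList-tab _ id))
              (lookup-tab n _ u)

    near-spec : ∀ u v → Decides (Near G u v) (⟦ nearCode ⟧ (g ∷ idx n u ∷ idx n v ∷ []))
    near-spec u v = decides-⊎ (equal-spec n u v) (adj-spec u v)

    cover-spec : ∀ S → Decides (Covering G S) (⟦ coverCode ⟧ (g ∷ encodeSubset S ∷ []))
    cover-spec S = fold-every n λ v a → fold-some n λ u a′ →
      decides-× (member-spec n S u) λ _ → near-spec u v

    grow-spec : ∀ S R → EncodesSet n (λ v → v ∈ S × ∃[ w ] w ∈ R × Near G w v)
      (⟦ growCode ⟧ (g ∷ encodeSubset S ∷ encodeSubset R ∷ []))
    grow-spec S R = fold-set n λ v a → decides-× (member-spec n S v) λ _ →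
      fold-some n λ w a′ → decides-× (member-spec n R w) λ _ → near-spec w v

    reach-spec : ∀ S u → u ∈ S → EncodesSet n (Walk G S u)
      (⟦ reachCode ⟧ (g ∷ encodeSubset S ∷ idx n u ∷ []))
    reach-spec S u u∈S = finish (foldNum-inv n Inv step (start _ singleton))
      where
      Grown : Subset n → Set
      Grown R = ∀ v → v ∈ S → ∀ w → w ∈ R → Near G w v → v ∈ R

      -- Every round enlarges the reached set until it is closed.
      data Inv (k : ℕ) : Tree → Set where
        inv : ∀ R → u ∈ R → R ⊆ S → (∀ v → v ∈ R → Walk G S u v) →
              Grown R ⊎ n < ∣ R ∣ + k → Inv k (encodeSubset R)

      singleton : EncodesSet n (_≡ u) (⟦ tabCode (call equalCode (`tl v0 ∷ v4 ∷ [])) ⟧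
        (g ∷ encodeSubset S ∷ idx n u ∷ []))
      singleton = fold-set n λ v a → equal-spec n v u

      start : ∀ t → EncodesSet n (_≡ u) t → Inv n t
      start _ (encodes R R⇒ ⇒R) =
        inv R (⇒R u refl) (λ x∈ → subst (_∈ S) (sym (R⇒ _ x∈)) u∈S)
          (λ v v∈ → subst (Walk G S u) (sym (R⇒ v v∈)) ε)
          (inj₂ (+-monoˡ-≤ n (nonempty (⇒R u refl))))
        where
        nonempty : ∀ {m} {x : Fin m} {p} → x ∈ p → 0 < ∣ p ∣
        nonempty {x = zero}  {true ∷ p}  _ = s≤s z≤n
        nonempty {x = suc x} {true ∷ p}  _ = s≤s z≤n
        nonempty {x = suc x} {false ∷ p} (Vec.there x∈) = nonempty x∈

      step : ∀ (i : Fin n) a → Inv (suc (toℕ i)) a →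
             Inv (toℕ i) (⟦ growCode ⟧ (g ∷ encodeSubset S ∷ a ∷ []))
      step i _ (inv R u∈R R⊆S sound alt) = next (grow-spec S R)
        where
        k : ℕ
        k = toℕ i
        next : ∀ {t} → EncodesSet n (λ v → v ∈ S × ∃[ w ] w ∈ R × Near G w v) t → Inv k t
        next (encodes R′ R′⇒ ⇒R′) = inv R′ (R⊆R′ u∈R) (λ x∈ → proj₁ (R′⇒ _ x∈)) sound′
          (grown? alt (⊆-or-witness R′ R))
          where
          R⊆R′ : R ⊆ R′
          R⊆R′ x∈ = ⇒R′ _ (R⊆S x∈ , _ , x∈ , inj₁ refl)
          sound′ : ∀ v → v ∈ R′ → Walk G S u v
          sound′ v v∈ with R′⇒ v v∈
          ... | v∈S , w , w∈ , near = sound w w∈ ◅◅ Near⇒Walk G (R⊆S w∈) v∈S near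
          close : R′ ⊆ R → Grown R′
          close R′⊆R v v∈S w w∈ near = ⇒R′ v (v∈S , w , R′⊆R w∈ , near)
          grown? : Grown R ⊎ n < ∣ R ∣ + suc k → R′ ⊆ R ⊎ (∃[ x ] x ∈ R′ × x ∉ R) →
                   Grown R′ ⊎ n < ∣ R′ ∣ + k
          grown? (inj₁ gr) _ = inj₁ (close λ x∈ →
            let x∈S , w , w∈ , near = R′⇒ _ x∈ in gr _ x∈S w w∈ near)
          grown? (inj₂ lt) (inj₁ sub) = inj₁ (close sub)
          grown? (inj₂ lt) (inj₂ (x , x∈ , x∉)) = inj₂ (<-≤-trans lt
            (≤-trans (≤-reflexive (+-suc ∣ R ∣ k))
              (+-monoˡ-≤ k (p⊂q⇒∣p∣<∣q∣ (R⊆R′ , x , x∈ , x∉)))))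

      finish : ∀ {t} → Inv 0 t → EncodesSet n (Walk G S u) t
      -- With no round left, the second alternative would give R more than n elements; so R is
      -- closed.
      finish (inv R u∈R R⊆S sound (inj₂ lt)) =
        contradiction (subst (n <_) (+-identityʳ ∣ R ∣) lt) (≤⇒≯ (∣p∣≤n R))
      finish (inv R u∈R R⊆S sound (inj₁ gr)) = encodes R sound λ v → complete u∈R
        where
        complete : ∀ {x v} → x ∈ R → Walk G S x v → v ∈ R
        complete x∈ ε = x∈
        complete x∈ ((_ , y∈ , xy) ◅ rest) = complete (gr _ y∈ _ x∈ (inj₂ xy)) rest

    connected-spec : ∀ S → Decides (∀ u → u ∈ S → ∀ v → v ∈ S → Walk G S u v)
      (⟦ connectedCode ⟧ (g ∷ encodeSubset S ∷ []))
    connected-spec S = fold-every n λ u a →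
      decides-→ (member-spec n S u) λ u∈ → fold-every n λ v a′ →
        decides-→ (member-spec n S v) λ v∈ → reached v (reach-spec S u u∈)
      where
      reached : ∀ {P t} v → EncodesSet n P t → Decides (P v) (⟦ lookupCode ⟧ (t ∷ idx n v ∷ []))
      reached v (encodes R R⇒ ⇒R) = decides-map (R⇒ v) (⇒R v) (member-spec n R v)

    -- The code does not test whether S is nonempty: since the graph has a vertex x, covering x
    -- already provides an element of S.
    cds-spec : Fin n → ∀ S →
      Decides (ConnectedDominating G S) (⟦ cdsCode ⟧ (g ∷ encodeSubset S ∷ []))
    cds-spec x S = decides-map
      (λ (cov , conn) → Covering⇒Dominating G cov ,
        (proj₁ (cov x) , proj₁ (proj₂ (cov x))) , λ u∈ v∈ → conn _ u∈ _ v∈)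
      (λ (dom , _ , conn) → Dominating⇒Covering G dom , λ u u∈ v v∈ → conn u∈ v∈)
      (decides-× (cover-spec S) λ _ → connected-spec S)

  data Minimised (S : Subset n) : Tree → Set where
    minimised : ∀ M → MinimalConnectedDominating G M → M ⊆ S → Minimised S (encodeSubset M)

  opaque
    unfolding minimiseCode

    -- One greedy pass suffices: by monotonicity, a vertex that could not be removed stays
    -- indispensable while the set shrinks further.
    minimise-spec : ∀ S → ConnectedDominating G S →
                    Minimised S (⟦ minimiseCode ⟧ (g ∷ encodeSubset S ∷ []))
    minimise-spec S cdS =
      finish (foldNum-inv n Inv step (inv S cdS id λ i le → contradiction le (<⇒≱ (toℕ<n i))))
      where
      x : Fin n
      x = proj₁ (proj₁ (proj₂ cdS))
      data Inv (k : ℕ) : Tree → Set where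
        inv : ∀ M → ConnectedDominating G M → M ⊆ S →
          (∀ i → k ≤ toℕ i → i ∈ M → ¬ ConnectedDominating G (remove i M)) →
          Inv k (encodeSubset M)

      choose : ∀ (i : Fin n) M {t s} → ConnectedDominating G M → M ⊆ S →
        (∀ j → suc (toℕ i) ≤ toℕ j → j ∈ M → ¬ ConnectedDominating G (remove j M)) →
        Decides (ConnectedDominating G (remove i M)) t → s ≡ encodeSubset (remove i M) →
        Inv (toℕ i) (select t s (encodeSubset M))
      choose i M cd M⊆S irr (holds cd′) refl = inv (remove i M) cd′ (M⊆S ∘ remove-⊆ i M)
        λ j le j∈ cd″ → [ (λ { refl → ∉-remove i M j∈ })
          , (λ lt → irr j lt (remove-⊆ i M j∈) (CD-mono G (remove-mono j (remove-⊆ i M)) cd″)) ]′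
          (split-≤ n refl le)
      choose i M cd M⊆S irr (fails ¬cd) _ = inv M cd M⊆S
        λ j le j∈ → [ (λ { refl → ¬cd }) , (λ lt → irr j lt j∈) ]′ (split-≤ n refl le)

      removed : ∀ i M →
        ⟦ updateCode `nil ⟧ (encodeSubset M ∷ idx n i ∷ []) ≡ encodeSubset (remove i M)
      removed i M = update-spec n `nil false (λ _ → refl) M i

      step : ∀ (i : Fin n) a → Inv (suc (toℕ i)) a →
             Inv (toℕ i) (⟦ minimiseBody ⟧ (num (suc (toℕ i)) ∷ a ∷ g ∷ encodeSubset S ∷ []))
      step i _ (inv M cd M⊆S irr) = choose i M cd M⊆S irr
        (subst (λ t → Decides (ConnectedDominating G (remove i M)) (⟦ cdsCode ⟧ (g ∷ t ∷ [])))
          (sym (removed i M)) (cds-spec x (remove i M)))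
        (removed i M)

      finish : ∀ {t} → Inv 0 t → Minimised S t
      finish (inv M cd M⊆S irr) = minimised M (minimal G cd λ i → irr i z≤n) M⊆S

-- Expanding one solution

child : Bool → Tree → Tree
child true  = tl
child false = hd

-- A set of subsets is a binary trie: the subset with bits b₁ … bₖ is present iff the node
-- reached from the root by the path b₁ … bₖ is not nil.
find : ∀ {k} → Subset k → Tree → Tree
find []      t = t
find (b ∷ D) t = find D (child b t)

put : ∀ {k} → Subset k → Tree → Tree
put []          t = cons nil nil
put (true ∷ D)  t = cons (hd t) (put D (tl t))
put (false ∷ D) t = cons (put D (hd t)) (tl t)

find-put : ∀ {k} (D : Subset k) t → find D (put D t) ≡ cons nil nil
find-put []          t = refl
find-put (true ∷ D)  t = find-put D (tl t)
find-put (false ∷ D) t = find-put D (hd t)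

find-put-≢ : ∀ {k} {D E : Subset k} t → D ≢ E → find D (put E t) ≡ find D t
find-put-≢ {D = []}        {[]}        t D≢E = contradiction refl D≢E
find-put-≢ {D = true ∷ D}  {true ∷ E}  t D≢E = find-put-≢ (tl t) (D≢E ∘ cong (true ∷_))
find-put-≢ {D = true ∷ D}  {false ∷ E} t D≢E = refl
find-put-≢ {D = false ∷ D} {true ∷ E}  t D≢E = refl
find-put-≢ {D = false ∷ D} {false ∷ E} t D≢E = find-put-≢ (hd t) (D≢E ∘ cong (false ∷_))

find-nil : ∀ {k} (D : Subset k) → find D nil ≡ nil
find-nil []          = refl
find-nil (true ∷ D)  = find-nil D
find-nil (false ∷ D) = find-nil D

opaque
  findCode putCode : Code 2
  findCode = bind
    (fold clock (`cons v0 v1)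
      (cond (`hd (`tl v1))
        (ret (`cons (`tl (`hd v1)) (`tl (`tl v1))))
        (ret (`cons (`hd (`hd v1)) (`tl (`tl v1))))))
    (ret (`hd v0))
  putCode = bind
    (fold clock (`cons v0 (`cons v1 `nil))
      (cond (`hd (`hd (`tl v1)))
        (ret (`cons (`tl (`hd v1)) (`cons (`tl (`hd (`tl v1)))
          (`cons (`cons (`hd (`hd (`tl v1))) (`hd v1)) (`tl (`tl v1))))))
        (ret (`cons (`hd (`hd v1)) (`cons (`tl (`hd (`tl v1)))
          (`cons (`cons (`hd (`hd (`tl v1))) (`hd v1)) (`tl (`tl v1))))))))
    (bind
      (fold clock (`cons yes′ (`tl (`tl v0)))
        (cond (`hd (`hd (`tl v1)))
          (ret (`cons (`cons (`hd (`tl (`hd (`tl v1)))) (`hd v1)) (`tl (`tl v1))))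
          (ret (`cons (`cons (`hd v1) (`tl (`tl (`hd (`tl v1))))) (`tl (`tl v1))))))
      (ret (`hd v0)))

opaque
  -- The arguments are the graph, a vertex set, the queue and the trie of the sets found so far.
  handleCode : Code 4
  handleCode = bind (call cdsCode (v0 ∷ v1 ∷ []))
    (cond v0
      (bind (call minimiseCode (v1 ∷ v2 ∷ []))
        (bind (call findCode (v5 ∷ v0 ∷ []))
          (cond v0
            (ret (`cons v5 v6))
            (bind (call putCode (v6 ∷ v1 ∷ []))
              (ret (`cons (`cons v2 v6) v0))))))
      (ret (`cons v3 v4)))

opaque
  initCode : Code 1
  initCode = bind (tabCode (ret yes′))
    (bind (call minimiseCode (v1 ∷ v0 ∷ []))
      (bind (call putCode (`nil ∷ v0 ∷ []))
        (ret (`cons (`cons v1 `nil) (`cons v0 (`cons v3 `nil))))))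

expandBody : Code 3
expandBody = fold clock v1
  (bind (call (updateCode yes′) (`hd v2 ∷ `tl v0 ∷ [])) (ret (`cons v0 v2)))

opaque
  expandCode : Code 1
  expandCode = fold (from v0) `nil expandBody

-- The exponent 3 deg v is never computed; instead the list is expanded three times for each
-- neighbour of v met in the scan.
candidatesBody : Code 6
candidatesBody = bind (call adjCode (v3 ∷ v5 ∷ `tl v0 ∷ []))
  (cond v0
    (bind (call expandCode (v2 ∷ []))
      (bind (call expandCode (v0 ∷ [])) (call expandCode (v0 ∷ []))))
    (ret v2))

opaque
  candidatesCode : Code 3
  candidatesCode = bind (call (updateCode `nil) (v1 ∷ v2 ∷ []))
    (fold clock (`cons v0 `nil) candidatesBody)

opaque
  vertexCode : Code 5
  vertexCode = bind (call candidatesCode (v0 ∷ v1 ∷ v2 ∷ []))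
    (fold (from v0) (`cons v4 v5)
      (call handleCode (v3 ∷ `hd v0 ∷ `hd v1 ∷ `tl v1 ∷ [])))

stepBody : Code 5
stepBody = bind (call lookupCode (`hd v2 ∷ `tl v0 ∷ []))
  (cond v0
    (call vertexCode (v5 ∷ `hd v3 ∷ `tl v1 ∷ `hd v2 ∷ `tl v2 ∷ []))
    (ret v2))

opaque
  stepCode : Code 3
  stepCode = bind (fold clock (`cons (`tl v0) v1) stepBody)
    (ret (`cons (`hd v0) (`cons (`tl v0) (`cons v3 `nil))))

opaque
  unfolding dropCode adjCode minimiseCode findCode handleCode initCode
    expandCode candidatesCode vertexCode stepCode

  update-flat : ∀ e → flat (updateCode e) ≡ true
  update-flat e = refl

  adj-flat : flat adjCode ≡ true
  adj-flat = refl

  lookup-flat : flat lookupCode ≡ true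
  lookup-flat = refl

  handle-flat : flat handleCode ≡ true
  handle-flat = refl

  init-flat : flat initCode ≡ true
  init-flat = refl

  expandBody-flat : flat expandBody ≡ true
  expandBody-flat = refl

  init-dep : dep initCode ≡ 0
  init-dep = refl

  -- List folds occur side by side or under clock folds, never inside each other. This is what keeps
  -- the exponent at 3Δ + O(1) instead of a multiple of it.
  step-dep : dep stepCode ≡ 1
  step-dep = refl

-- Peels off the last round instead of the first, as the upward pass through a trie requires: there
-- the root is rebuilt last.
foldNum-const : ∀ (f : Tree → Tree) k a →
  foldTree (λ _ → f) (num (suc k)) a ≡ f (foldTree (λ _ → f) (num k) a)
foldNum-const f zero    a = refl
foldNum-const f (suc k) a = foldNum-const f k (f a)

module _ (n : ℕ) where
  open Semantics n

  opaque
    unfolding findCode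

    find-spec : ∀ (D : Subset n) t → ⟦ findCode ⟧ (t ∷ encodeSubset D ∷ []) ≡ find D t
    find-spec D t = cong hd (go D t)
      where
      descend : Tree → Tree
      descend a = select (hd (tl a)) (cons (tl (hd a)) (tl (tl a))) (cons (hd (hd a)) (tl (tl a)))
      go : ∀ {k} (D : Subset k) t →
           foldTree (λ _ → descend) (num k) (cons t (encodeSubset D)) ≡ cons (find D t) nil
      go []          t = refl
      go (true ∷ D)  t = go D (tl t)
      go (false ∷ D) t = go D (hd t)

    -- Going down, each node is stacked together with the bit read there; going up, the stack
    -- returns the nodes in the order in which they must be rebuilt.
    put-spec : ∀ (D : Subset n) t → ⟦ putCode ⟧ (t ∷ encodeSubset D ∷ []) ≡ put D t
    put-spec D t = trans
      (cong (λ s → hd (foldTree (λ _ → ascend) (num n) (cons (cons nil nil) (tl (tl s)))))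
        (down D t nil))
      (cong hd (up D t nil))
      where
      descend ascend : Tree → Tree
      descend a = select (hd (hd (tl a)))
        (cons (tl (hd a)) (cons (tl (hd (tl a))) (cons (cons (hd (hd (tl a))) (hd a)) (tl (tl a)))))
        (cons (hd (hd a)) (cons (tl (hd (tl a))) (cons (cons (hd (hd (tl a))) (hd a)) (tl (tl a)))))
      ascend a = select (hd (hd (tl a)))
        (cons (cons (hd (tl (hd (tl a)))) (hd a)) (tl (tl a)))
        (cons (cons (hd a) (tl (tl (hd (tl a))))) (tl (tl a)))
      path : ∀ {k} → Subset k → Tree → Tree → Tree
      path []      t s = s
      path (b ∷ D) t s = path D (child b t) (cons (cons (encodeBool b) t) s)
      down : ∀ {k} (D : Subset k) t s →
        foldTree (λ _ → descend) (num k) (cons t (cons (encodeSubset D) s))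
          ≡ cons (find D t) (cons nil (path D t s))
      down []          t s = refl
      down (true ∷ D)  t s = down D (tl t) _
      down (false ∷ D) t s = down D (hd t) _
      up : ∀ {k} (D : Subset k) t s →
        foldTree (λ _ → ascend) (num k) (cons (cons nil nil) (path D t s)) ≡ cons (put D t) s
      up []              t s = refl
      up {suc k} (true ∷ D)  t s =
        trans (foldNum-const ascend k _) (cong ascend (up D (tl t) _))
      up {suc k} (false ∷ D) t s =
        trans (foldNum-const ascend k _) (cong ascend (up D (hd t) _))

-- Invariants of the queue and the trie

record Good {n} (G : Graph n) (seen : List (Subset n)) (vis : Tree) : Set where
  field
    sound   : ∀ {D} → D ∈ˡ seen → MinimalConnectedDominating G D
    unique  : Unique seen
    present : ∀ D → D ∈ˡ seen → find D vis ≢ nil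
    absent  : ∀ D → find D vis ≢ nil → D ∈ˡ seen

open Good public

module _ {n : ℕ} (G : Graph n) where
  open Semantics n

  private
    g = encodeGraph G

  add-good : ∀ {seen vis M} → Good G seen vis → MinimalConnectedDominating G M →
    find M vis ≡ nil → Good G (M ∷ seen) (put M vis)
  add-good {seen} {vis} {M} gd mM new = record
    { sound   = λ { (here refl) → mM ; (there D∈) → sound gd D∈ }
    ; unique  = All.tabulate (λ { D∈ refl → present gd M D∈ new }) ∷ unique gd
    ; present = present′
    ; absent  = absent′
    }
    where
    present′ : ∀ D → D ∈ˡ M ∷ seen → find D (put M vis) ≢ nil
    present′ D D∈ eq with ≡-dec Bool._≟_ D M
    ... | yes refl = cons≢nil (trans (sym (find-put M vis)) eq)
    present′ D (here refl) eq | no D≢M = contradiction refl D≢M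
    present′ D (there D∈)  eq | no D≢M =
      present gd D D∈ (trans (sym (find-put-≢ vis D≢M)) eq)
    absent′ : ∀ D → find D (put M vis) ≢ nil → D ∈ˡ M ∷ seen
    absent′ D ne with ≡-dec Bool._≟_ D M
    ... | yes refl = here refl
    ... | no D≢M = there (absent gd D λ eq → ne (trans (find-put-≢ vis D≢M) eq))

  encodeSets : List (Subset n) → Tree
  encodeSets = encodeList encodeSubset

  -- A queue q and a trie in which every connected dominating set among the goals has been
  -- accounted for by some solution inside it; done are the solutions already output.
  data Progress (done old : List (Subset n)) (Goal : Subset n → Set) : Tree → Set where
    progress : ∀ q vis → Good G (q ++ done) vis → (∀ {D} → D ∈ˡ old → D ∈ˡ q ++ done) →
      (∀ S → Goal S → ConnectedDominating G S → ∃[ M ] M ∈ˡ q ++ done × M ⊆ S) →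
      Progress done old Goal (cons (encodeSets q) vis)

  Progress-map : ∀ {done old P Q t} → (∀ S → Q S → P S) →
                 Progress done old P t → Progress done old Q t
  Progress-map f (progress q vis gd keep goals) =
    progress q vis gd keep λ S Q → goals S (f S Q)

  opaque
    unfolding handleCode

    handle-spec : Fin n → ∀ {done old P} S {a} → Progress done old P a →
      Progress done old (λ T → T ≡ S ⊎ P T)
        (⟦ handleCode ⟧ (g ∷ encodeSubset S ∷ hd a ∷ tl a ∷ []))
    handle-spec x {done} {old} {P} S (progress q vis gd keep goals) = checked (cds-spec G x S)
      where
      Result : Tree → Set
      Result = Progress done old λ T → T ≡ S ⊎ P T

      insert-new : ∀ M {t} → MinimalConnectedDominating G M → M ⊆ S → t ≡ find M vis →
        Result (select t (cons (encodeSets q) vis)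
          (cons (cons (encodeSubset M) (encodeSets q)) (put M vis)))
      insert-new M {nil} mM M⊆S eq =
        progress (M ∷ q) (put M vis) (add-good gd mM (sym eq)) (there ∘ keep) λ where
          T (inj₁ refl) _ → M , here refl , M⊆S
          T (inj₂ p) cd → let M′ , M′∈ , M′⊆ = goals T p cd in M′ , there M′∈ , M′⊆
      -- A hit in the trie: M has been met before and already accounts for S.
      insert-new M {cons a b} mM M⊆S eq = progress q vis gd keep λ where
        T (inj₁ refl) _ → M , absent gd M (λ e → cons≢nil (trans eq e)) , M⊆S
        T (inj₂ p) cd → goals T p cd

      minimised′ : ∀ {m} → Minimised G S m →
        Result (select (⟦ findCode ⟧ (vis ∷ m ∷ [])) (cons (encodeSets q) vis)
          (cons (cons m (encodeSets q)) (⟦ putCode ⟧ (vis ∷ m ∷ []))))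
      minimised′ (minimised M mM M⊆S) =
        subst (λ t → Result (select (⟦ findCode ⟧ (vis ∷ encodeSubset M ∷ []))
            (cons (encodeSets q) vis) (cons (cons (encodeSubset M) (encodeSets q)) t)))
           (sym (put-spec n M vis))
          (insert-new M mM M⊆S (find-spec n M vis))

      checked : ∀ {t} → Decides (ConnectedDominating G S) t →
        Result (select t
          (select (⟦ findCode ⟧ (vis ∷ ⟦ minimiseCode ⟧ (g ∷ encodeSubset S ∷ []) ∷ []))
            (cons (encodeSets q) vis)
            (cons (cons (⟦ minimiseCode ⟧ (g ∷ encodeSubset S ∷ [])) (encodeSets q))
              (⟦ putCode ⟧ (vis ∷ ⟦ minimiseCode ⟧ (g ∷ encodeSubset S ∷ []) ∷ []))))
          (cons (encodeSets q) vis))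
      checked (holds cd)  = minimised′ (minimise-spec G S cd)
      checked (fails ¬cd) = progress q vis gd keep λ where
        T (inj₁ refl) cd → contradiction cd ¬cd
        T (inj₂ p) cd → goals T p cd

  opaque
    unfolding initCode

    init-spec : ConnectedDominating G ⊤ˢ → ∃[ M ] ∃[ vis ]
      ⟦ initCode ⟧ (g ∷ []) ≡ cons (encodeSets (M ∷ [])) (cons vis (cons g nil)) ×
      Good G (M ∷ []) vis
    init-spec cd = build (trans (fold-tab n {f = λ _ → cons nil nil} λ i a → refl) (full n))
      where
      full : ∀ k → tab {k} (λ _ → cons nil nil) ≡ encodeSubset {k} ⊤ˢ
      full zero    = refl
      full (suc k) = cong (cons _) (full k)

      empty : Good G [] nil
      empty = record { sound = λ () ; unique = [] ; present = λ _ ()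
                     ; absent = λ D ne → contradiction (find-nil D) ne }

      Result : Tree → Set
      Result m = ∃[ M ] ∃[ vis ]
        cons (cons m nil) (cons (⟦ putCode ⟧ (nil ∷ m ∷ [])) (cons g nil))
          ≡ cons (encodeSets (M ∷ [])) (cons vis (cons g nil)) × Good G (M ∷ []) vis

      start : ∀ {m} → Minimised G ⊤ˢ m → Result m
      start (minimised M mM _) = M , put M nil ,
        cong (λ t → cons (cons (encodeSubset M) nil) (cons t (cons g nil))) (put-spec n M nil) ,
        add-good empty mM (find-nil M)

      build : ∀ {t} → t ≡ encodeSubset {n} ⊤ˢ → Result (⟦ minimiseCode ⟧ (g ∷ t ∷ []))
      build refl = start (minimise-spec G ⊤ˢ cd)

  insert-spec : ∀ S i →
    ⟦ updateCode yes′ ⟧ (encodeSubset S ∷ idx n i ∷ []) ≡ encodeSubset (insert i S)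
  insert-spec = update-spec n yes′ true λ _ → refl

  opaque
    unfolding expandCode

    expand-spec : ∀ L → ∃[ L′ ] ⟦ expandCode ⟧ (encodeSets L ∷ []) ≡ encodeSets L′ ×
      length L′ ≡ n * length L × (∀ S x → S ∈ˡ L → insert x S ∈ˡ L′)
    expand-spec L = let L′ , eq , len , _ , ins = outer L []
                    in L′ , eq , trans len (+-identityʳ _) , ins
      where
      inner : ∀ S A r → ∃[ A′ ]
        ⟦ expandBody ⟧ (cons (encodeSubset S) r ∷ encodeSets A ∷ encodeSets L ∷ []) ≡ encodeSets A′ ×
        length A′ ≡ n + length A × (∀ {T} → T ∈ˡ A → T ∈ˡ A′) × (∀ x → insert x S ∈ˡ A′)
      inner S A r =
        let A′ , eq , len , keep , ins = foldNum-inv n Inv step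
              (A , refl , +-comm (length A) n , id , λ x le → contradiction le (<⇒≱ (toℕ<n x)))
        in A′ , eq , trans (sym (+-identityʳ _)) len , keep , λ x → ins x z≤n
        where
        Inv : ℕ → Tree → Set
        Inv k a = ∃[ A′ ] a ≡ encodeSets A′ × length A′ + k ≡ n + length A ×
          (∀ {T} → T ∈ˡ A → T ∈ˡ A′) × (∀ x → k ≤ toℕ x → insert x S ∈ˡ A′)
        step : ∀ (i : Fin n) a → Inv (suc (toℕ i)) a →
          Inv (toℕ i) (cons (⟦ updateCode yes′ ⟧ (encodeSubset S ∷ idx n i ∷ [])) a)
        step i a (A′ , refl , len , keep , ins) =
          insert i S ∷ A′ , cong (λ t → cons t _) (insert-spec S i) ,
          trans (sym (+-suc (length A′) (toℕ i))) len , there ∘ keep ,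
          λ x le → [ (λ { refl → here refl }) , (λ lt → there (ins x lt)) ]′ (split-≤ n refl le)

      outer : ∀ Q A → ∃[ A′ ]
        foldTree (λ l a → ⟦ expandBody ⟧ (l ∷ a ∷ encodeSets L ∷ [])) (encodeSets Q) (encodeSets A)
          ≡ encodeSets A′ ×
        length A′ ≡ n * length Q + length A ×
        (∀ {T} → T ∈ˡ A → T ∈ˡ A′) × (∀ S x → S ∈ˡ Q → insert x S ∈ˡ A′)
      outer [] A = A , refl , cong (_+ length A) (sym (*-zeroʳ n)) , id , λ S x ()
      outer (S ∷ Q) A =
        let A₁ , eq₁ , len₁ , keep₁ , ins₁ = inner S A (encodeSets Q)
            A₂ , eq₂ , len₂ , keep₂ , ins₂ = outer Q A₁
        in A₂ , trans (cong (foldTree _ (encodeSets Q)) eq₁) eq₂ ,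
           trans len₂ (trans (cong (n * length Q +_) len₁) (total (length Q) (length A))) ,
           keep₂ ∘ keep₁ ,
           λ { T x (here refl) → keep₂ (ins₁ x) ; T x (there T∈) → ins₂ T x T∈ }
        where
        total : ∀ q a → n * q + (n + a) ≡ n * suc q + a
        total q a = trans (sym (+-assoc (n * q) n a))
          (cong (_+ a) (trans (+-comm (n * q) n) (sym (*-suc n q))))

  record Candidates (B : Subset n) (m : ℕ) (t : Tree) : Set where
    constructor candidates
    field
      sets     : List (Subset n)
      encoded  : t ≡ encodeSets sets
      number   : length sets ≡ n ^ m
      complete : ∀ X → length X ≡ m → insertAll X B ∈ˡ sets

  expand-candidates : ∀ {B m t} → Candidates B m t → Candidates B (suc m) (⟦ expandCode ⟧ (t ∷ []))
  expand-candidates {B} {m} (candidates L refl num comp) =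
    let L′ , eq , len , ins = expand-spec L
    in candidates L′ eq (trans len (cong (n *_) num)) (complete′ ins)
    where
    complete′ : ∀ {L′} → (∀ S x → S ∈ˡ L → insert x S ∈ˡ L′) →
                ∀ X → length X ≡ suc m → insertAll X B ∈ˡ L′
    -- An expansion inserts its vertex after all earlier ones, so the sequence is split at its end.
    complete′ ins X len with initLast X
    complete′ ins .[] () | []
    complete′ ins .(X ∷ʳ x) len | X ∷ʳ′ x =
      subst (_∈ˡ _) (sym (insertAll-++ X (x ∷ []) B)) (ins _ x (comp X
        (suc-injective (trans (+-comm 1 (length X)) (trans (sym (length-++ X)) len)))))

  recast : ∀ {B m m′ t} → m ≡ m′ → Candidates B m t → Candidates B m′ t
  recast refl c = c

  -- Counts the elements of index at least the given number: for a neighbourhood, the neighbours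
  -- that the descending scan has already treated.
  above : ∀ {k} → ℕ → Subset k → ℕ
  above zero    p       = ∣ p ∣
  above (suc k) []      = 0
  above (suc k) (_ ∷ p) = above k p

  above-∈ : ∀ {k} {i : Fin k} p → i ∈ p → above (toℕ i) p ≡ suc (above (suc (toℕ i)) p)
  above-∈ {i = zero}  (true ∷ p) _                = refl
  above-∈ {i = suc i} (_ ∷ p)    (Vec.there i∈) = above-∈ p i∈

  above-∉ : ∀ {k} {i : Fin k} p → i ∉ p → above (toℕ i) p ≡ above (suc (toℕ i)) p
  above-∉ {i = zero}  (true ∷ p)  i∉ = contradiction Vec.here i∉
  above-∉ {i = zero}  (false ∷ p) i∉ = refl
  above-∉ {i = suc i} (_ ∷ p)     i∉ = above-∉ p (i∉ ∘ Vec.there)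

  above-end : ∀ {k} (p : Subset k) → above k p ≡ 0
  above-end []      = refl
  above-end (_ ∷ p) = above-end p

  above-≤ : ∀ {k} i (p : Subset k) → above i p ≤ ∣ p ∣
  above-≤ zero    p           = ≤-refl
  above-≤ (suc i) []          = z≤n
  above-≤ (suc i) (true ∷ p)  = m≤n⇒m≤1+n (above-≤ i p)
  above-≤ (suc i) (false ∷ p) = above-≤ i p

  module _ (D : Subset n) (v : Fin n) where

    Level : ℕ → Tree → Set
    Level k = Candidates (remove v D) (3 * above k (neighbours G v))

    candidates-step : ∀ (w : Fin n) a → Level (suc (toℕ w)) a →
      Level (toℕ w) (⟦ candidatesBody ⟧
        (num (suc (toℕ w)) ∷ a ∷ encodeSubset (remove v D) ∷ g ∷ encodeSubset D ∷ idx n v ∷ []))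
    candidates-step w a c = choose (adj-spec G v w)
      where
      c₃ = expand-candidates (expand-candidates (expand-candidates c))
      choose : ∀ {t} → Decides (Adj G v w) t → Level (toℕ w)
        (select t (⟦ expandCode ⟧ (⟦ expandCode ⟧ (⟦ expandCode ⟧ (a ∷ []) ∷ []) ∷ [])) a)
      choose (holds vw) =
        recast
          (sym (trans (cong (3 *_) (above-∈ (neighbours G v) (∈-neighbours G vw))) (*-suc 3 _))) c₃
      choose (fails ¬vw) =
        recast
          (sym (cong (3 *_) (above-∉ (neighbours G v) (¬vw ∘ ∈-neighbours⁻ G)))) c

    level-start : Level n (cons (encodeSubset (remove v D)) nil)
    level-start = recast
      (sym (cong (3 *_) (above-end (neighbours G v))))
      (candidates (remove v D ∷ []) refl refl λ { [] _ → here refl })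

    removed : ⟦ updateCode `nil ⟧ (encodeSubset D ∷ idx n v ∷ []) ≡ encodeSubset (remove v D)
    removed = update-spec n `nil false (λ _ → refl) D v

    opaque
      unfolding candidatesCode

      candidates-spec : Candidates (remove v D) (3 * degree G v)
        (⟦ candidatesCode ⟧ (g ∷ encodeSubset D ∷ idx n v ∷ []))
      candidates-spec = build removed
        where
        build : ∀ {t} → t ≡ encodeSubset (remove v D) →
          Level 0 (foldTree
            (λ l a → ⟦ candidatesBody ⟧ (l ∷ a ∷ t ∷ g ∷ encodeSubset D ∷ idx n v ∷ []))
            (num n) (cons t nil))
        build refl = foldNum-inv n Level candidates-step level-start

    opaque
      unfolding vertexCode

      vertex-spec : ∀ {done old P a} → Progress done old P a →
        Progress done old
          (λ T → P T ⊎ ∃[ X ] length X ≡ 3 * degree G v × T ≡ insertAll X (remove v D))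
          (⟦ vertexCode ⟧ (g ∷ encodeSubset D ∷ idx n v ∷ hd a ∷ tl a ∷ []))
      vertex-spec {done} {old} {P} {a} (progress q vis gd keep goals) = build candidates-spec
        where
        handleAll : ∀ {P a} L → Progress done old P a → Progress done old (λ T → P T ⊎ T ∈ˡ L)
          (foldTree (λ l b → ⟦ handleCode ⟧ (g ∷ hd l ∷ hd b ∷ tl b ∷ [])) (encodeSets L) a)
        handleAll [] pr = Progress-map (λ { S (inj₁ p) → p }) pr
        handleAll (S ∷ L) pr = Progress-map
          (λ { T (inj₁ p) → inj₁ (inj₂ p)
             ; T (inj₂ (here eq)) → inj₁ (inj₁ eq)
             ; T (inj₂ (there T∈)) → inj₂ T∈ })
          (handleAll L (handle-spec v S pr))
        build : ∀ {t} → Candidates (remove v D) (3 * degree G v) t →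
          Progress done old
            (λ T → P T ⊎ ∃[ X ] length X ≡ 3 * degree G v × T ≡ insertAll X (remove v D))
            (foldTree (λ l b → ⟦ handleCode ⟧ (g ∷ hd l ∷ hd b ∷ tl b ∷ [])) t (cons (encodeSets q) vis))
        build (candidates L refl _ comp) = Progress-map
          (λ { T (inj₁ p) → inj₁ p ; T (inj₂ (X , len , refl)) → inj₂ (comp X len) })
          (handleAll L (progress q vis gd keep goals))

  -- The sets that must have been handled once all vertices from k upwards have been tried for
  -- removal.
  Successor : Subset n → ℕ → Subset n → Set
  Successor D k T = ∃[ v ] ∃[ X ] k ≤ toℕ v × v ∈ D × length X ≡ 3 * degree G v ×
    T ≡ insertAll X (remove v D)

  opaque
    unfolding stepCode

    step-spec : ∀ {done} D q vis → Good G (q ++ D ∷ done) vis →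
      ∃[ q′ ] ∃[ vis′ ]
        ⟦ stepCode ⟧ (encodeSets (D ∷ q) ∷ vis ∷ g ∷ []) ≡ cons (encodeSets q′) (cons vis′ (cons g nil)) ×
        Good G (q′ ++ D ∷ done) vis′ ×
        (∀ {E} → E ∈ˡ q ++ D ∷ done → E ∈ˡ q′ ++ D ∷ done) ×
        Expanded G (q′ ++ D ∷ done) D
    step-spec {done} D q vis gd = finish (foldNum-inv n Inv step
        (progress q vis gd id λ S (v , _ , le , _) → contradiction le (<⇒≱ (toℕ<n v))))
      where
      Inv : ℕ → Tree → Set
      Inv k = Progress (D ∷ done) (q ++ D ∷ done) (Successor D k)

      step : ∀ (v : Fin n) a → Inv (suc (toℕ v)) a →
        Inv (toℕ v) (⟦ stepBody ⟧ (num (suc (toℕ v)) ∷ a ∷ encodeSets (D ∷ q) ∷ vis ∷ g ∷ []))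
      step v a pr = choose (member-spec n D v)
        where
        choose : ∀ {t} → Decides (v ∈ D) t → Inv (toℕ v)
          (select t (⟦ vertexCode ⟧ (g ∷ encodeSubset D ∷ idx n v ∷ hd a ∷ tl a ∷ [])) a)
        choose (holds v∈) = Progress-map
          (λ S (w , X , le , w∈ , len , eq) →
            [ (λ { refl → inj₂ (X , len , eq) }) , (λ lt → inj₁ (w , X , lt , w∈ , len , eq)) ]′
            (split-≤ n refl le))
          (vertex-spec D v pr)
        choose (fails v∉) = Progress-map
          (λ S (w , X , le , w∈ , len , eq) →
            [ (λ { refl → contradiction w∈ v∉ }) , (λ lt → w , X , lt , w∈ , len , eq) ]′
            (split-≤ n refl le))
          pr

      finish : ∀ {a} → Inv 0 a → ∃[ q′ ] ∃[ vis′ ]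
        cons (hd a) (cons (tl a) (cons g nil)) ≡ cons (encodeSets q′) (cons vis′ (cons g nil)) ×
        Good G (q′ ++ D ∷ done) vis′ ×
        (∀ {E} → E ∈ˡ q ++ D ∷ done → E ∈ˡ q′ ++ D ∷ done) ×
        Expanded G (q′ ++ D ∷ done) D
      finish (progress q′ vis′ gd′ keep goals) = q′ , vis′ , refl , gd′ , keep ,
        λ v v∈ X len → goals _ (v , X , z≤n , v∈ , len , refl)

-- Running times and the enumeration loop

-- For bodies whose lists are short only on accumulators that actually arise, so that the lengths
-- have to be certified by an invariant.
okFold-num : ∀ n (I : ℕ → Tree → Set) {f ok} →
  (∀ (i : Fin n) a → I (suc (toℕ i)) a → I (toℕ i) (f (num (suc (toℕ i))) a)) →
  (∀ (i : Fin n) a → I (suc (toℕ i)) a → ok (num (suc (toℕ i))) a) →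
  ∀ {a} → I n a → OkFold f ok (num n) a
okFold-num n I {f} {ok} step good = go n ≤-refl
  where
  go : ∀ k → k ≤ n → ∀ {a} → I k a → OkFold f ok (num k) a
  go zero    k≤n     i = tt
  go (suc k) k<n {a} i =
    subst (λ j → I (suc j) a → ok (num (suc j)) a) (toℕ-fromℕ< k<n) (good (fromℕ< k<n) a) i ,
    go k (<⇒≤ k<n) (subst (λ j → I (suc j) a → I j (f (num (suc j)) a)) (toℕ-fromℕ< k<n)
      (step (fromℕ< k<n) a) i)

degree-≤ : ∀ {n} (G : Graph n) v → degree G v ≤ maxDegree G
degree-≤ {n} G v = foldr-preservesᵒ
  (λ x y → [ (λ le → m≤n⇒m≤n⊔o y le) , (λ le → m≤n⇒m≤o⊔n x le) ]′) 0
  (List.map (degree G) (allFin n))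
  (inj₂ (Any.map ≤-reflexive (∈-map⁺ (degree G) (∈-allFin v))))

spine-encodeList : ∀ {A : Set} (e : A → Tree) xs → spine (encodeList e xs) ≡ length xs
spine-encodeList e []       = refl
spine-encodeList e (x ∷ xs) = cong suc (spine-encodeList e xs)

-- Lengths of the candidate lists

module Bounds {n : ℕ} (G : Graph n) (1≤n : 1 ≤ n) where

  -- Ok covers both branches of a conditional, so it also asks for bounds on the expansions
  -- that would be made for a vertex that is not a neighbour; hence the summand 2.
  M : ℕ
  M = n ^ (3 * maxDegree G + 2)

  private
    instance
      n≢0 : NonZero n
      n≢0 = >-nonZero 1≤n

    g = encodeGraph G

  open Semantics n
  open Cost n M 1≤n (m^n>0 n (3 * maxDegree G + 2)) public

  -- j is the number of expansions already made for the vertex under inspection.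
  power-≤ : ∀ {m} v j → j ≤ 2 → m ≤ 3 * degree G v → n ^ (j + m) ≤ M
  power-≤ v j j≤2 m≤ = ^-monoʳ-≤ n
    (≤-trans (+-mono-≤ j≤2 (≤-trans m≤ (*-monoʳ-≤ 3 (degree-≤ G v))))
      (≤-reflexive (+-comm 2 (3 * maxDegree G))))

  candidates-spine : ∀ {B m t} → Candidates G B m t → n ^ m ≤ M → spine t ≤ M
  candidates-spine (candidates L refl num _) le =
    ≤-trans (≤-reflexive (trans (spine-encodeList encodeSubset L) num)) le

  opaque
    unfolding expandCode

    expand-ok : ∀ {B m t} → Candidates G B m t → n ^ m ≤ M → Ok expandCode (t ∷ [])
    expand-ok {t = t} c le = candidates-spine c le ,
      okFold _ (λ l a → flat⇒Ok expandBody expandBody-flat (l ∷ a ∷ t ∷ [])) t nil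

  candidatesBody-ok : ∀ (D : Subset n) (v w : Fin n) a → Level G D v (suc (toℕ w)) a →
    Ok candidatesBody
      (num (suc (toℕ w)) ∷ a ∷ encodeSubset (remove v D) ∷ g ∷ encodeSubset D ∷ num (toℕ v) ∷ [])
  candidatesBody-ok D v w a c =
    flat⇒Ok adjCode adj-flat _ ,
    (expand-ok c (power-≤ v 0 z≤n le) ,
     expand-ok c₁ (power-≤ v 1 (s≤s z≤n) le) ,
     expand-ok c₂ (power-≤ v 2 ≤-refl le)) ,
    tt
    where
    le = *-monoʳ-≤ 3 (above-≤ G (suc (toℕ w)) (neighbours G v))
    c₁ = expand-candidates G c
    c₂ = expand-candidates G c₁

  opaque
    unfolding candidatesCode

    candidates-ok : ∀ (D : Subset n) (v : Fin n) →
      Ok candidatesCode (g ∷ encodeSubset D ∷ num (toℕ v) ∷ [])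
    candidates-ok D v = flat⇒Ok (updateCode `nil) (update-flat `nil) _ , tt , build (removed G D v)
      where
      build : ∀ {t} → t ≡ encodeSubset (remove v D) → OkFold
        (λ l a → ⟦ candidatesBody ⟧ (l ∷ a ∷ t ∷ g ∷ encodeSubset D ∷ num (toℕ v) ∷ []))
        (λ l a → Ok candidatesBody (l ∷ a ∷ t ∷ g ∷ encodeSubset D ∷ num (toℕ v) ∷ []))
        (num n) (cons t nil)
      build refl = okFold-num n (Level G D v) (candidates-step G D v) (candidatesBody-ok D v)
        (level-start G D v)

  opaque
    unfolding vertexCode

    vertex-ok : ∀ (D : Subset n) (v : Fin n) q vis →
      Ok vertexCode (g ∷ encodeSubset D ∷ num (toℕ v) ∷ q ∷ vis ∷ [])
    vertex-ok D v q vis = candidates-ok D v ,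
      candidates-spine (candidates-spec G D v) (power-≤ v 0 z≤n ≤-refl) ,
      okFold _ (λ l a → flat⇒Ok handleCode handle-flat _)
        (⟦ candidatesCode ⟧ (g ∷ encodeSubset D ∷ num (toℕ v) ∷ [])) (cons q vis)

  opaque
    unfolding stepCode

    step-ok : ∀ (D : Subset n) q vis → Ok stepCode (cons (encodeSubset D) q ∷ vis ∷ g ∷ [])
    step-ok D q vis = (tt , okFold-num n (λ _ _ → ⊤) (λ _ _ _ → tt)
      (λ i a _ → flat⇒Ok lookupCode lookup-flat _ , vertex-ok D i (hd a) (tl a) , tt) tt) , tt

  step-bound : ∀ (D : Subset n) q vis → Bound (steps stepCode (cons (encodeSubset D) q ∷ vis ∷ g ∷ []))
                             (coef stepCode) (deg stepCode) 1
  step-bound D q vis =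
    widen ≤-refl (≤-reflexive step-dep) (steps-≤ stepCode _ (step-ok D q vis))

  init-bound : Bound (steps initCode (g ∷ [])) (coef initCode) (deg initCode) 1
  init-bound = widen ≤-refl (≤-trans (≤-reflexive init-dep) z≤n)
    (steps-≤ initCode _ (flat⇒Ok initCode init-flat _))

-- Counting subsets and running the loop

bit : Bool → Fin 2
bit false = 0F
bit true  = 1F

bit-injective : ∀ {b c} → bit b ≡ bit c → b ≡ c
bit-injective {false} {false} _ = refl
bit-injective {true}  {true}  _ = refl

number : ∀ {n} → Subset n → Fin (2 ^ n)
number []      = zero
number (b ∷ D) = Fin.combine (bit b) (number D)

number-injective : ∀ {n} {D E : Subset n} → number D ≡ number E → D ≡ E
number-injective {D = []}    {[]}    _  = refl
number-injective {D = b ∷ D} {c ∷ E} eq with combine-injective (bit b) _ _ _ eq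
... | p , q = cong₂ _∷_ (bit-injective p) (number-injective q)

-- Pigeonhole on the binary numbers of the subsets; it bounds the number of rounds of the main loop.
unique-length-≤ : ∀ {n} {xs : List (Subset n)} → Unique xs → length xs ≤ 2 ^ n
unique-length-≤ {n} {xs} uniq = ≮⇒≥ λ lt →
  let i , j , i<j , eq = pigeonhole lt (number ∘ List.lookup xs)
  in distinct xs uniq i<j (number-injective eq)
  where
  distinct : ∀ (xs : List (Subset n)) → Unique xs → ∀ {i j} → i Fin.< j →
             List.lookup xs i ≢ List.lookup xs j
  distinct (x ∷ xs) (x∉ ∷ _) {zero}  {suc j} _         = All.lookup x∉ (∈-lookup {xs = xs} j)
  distinct (x ∷ xs) (_ ∷ u)  {suc i} {suc j} (s≤s i<j) = distinct xs u i<j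

good-↭ : ∀ {n} {G : Graph n} {seen seen′ vis} → seen ↭ seen′ → Good G seen vis → Good G seen′ vis
good-↭ p gd = record
  { sound   = sound gd ∘ ∈-resp-↭ (↭-sym p)
  ; unique  = ↭ₛ.Unique-resp-↭ (setoid _) (↭⇒↭ₛ p) (unique gd)
  ; present = λ D → present gd D ∘ ∈-resp-↭ (↭-sym p)
  ; absent  = λ D → ∈-resp-↭ p ∘ absent gd D
  }

delaysFrom-ticks : ∀ m k τ → delaysFrom m (ticks k ++ τ) ≡ delaysFrom (k + m) τ
delaysFrom-ticks m zero    τ = refl
delaysFrom-ticks m (suc k) τ =
  trans (delaysFrom-ticks (suc m) k τ) (cong (λ t → delaysFrom t τ) (+-suc k m))

outputs-ticks : ∀ k τ → outputs (ticks k ++ τ) ≡ outputs τ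
outputs-ticks zero    τ = refl
outputs-ticks (suc k) τ = outputs-ticks k τ

size-encodeSubset : ∀ {n} (D : Subset n) → size (encodeSubset D) ≤ n * 4 + 1
size-encodeSubset []      = ≤-refl
size-encodeSubset (b ∷ D) = s≤s (+-mono-≤ (size-bit b) (size-encodeSubset D))
  where
  size-bit : ∀ b → size (encodeBool b) ≤ 3
  size-bit false = s≤s z≤n
  size-bit true  = ≤-refl

-- The coefficient mirrors `delay` summand by summand; the 1 in the degree makes room for the terms
-- linear in n.
delayCoef delayDeg : ℕ
delayCoef = 6 + (4 + 1) + ((4 + ((9 + 2) + (coef initCode + 2))) + (coef stepCode + 2))
delayDeg  = 1 ⊔ (deg initCode ⊔ deg stepCode)

clockCode enumerateCode : Cmd 3
clockCode     = while (var 0F) (2F := `cons `nil (var 2F) ⨾ 0F := `tl (var 0F))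
enumerateCode = while (`hd (var 1F))
  (output (`hd (`hd (var 1F))) ⨾ compile stepCode ⨾ 1F := var 0F)

enumerator : Program
enumerator = program {2}
  (1F := `cons (var 0F) `nil ⨾ clockCode ⨾ compile initCode ⨾ 1F := var 0F ⨾ enumerateCode)

clock-run : ∀ t e k → clockCode ⊢ t ∷ e ∷ num k ∷ [] ⇓ nil ∷ e ∷ num (spine t + k) ∷ [] ∣
                        ticks (spine t * 9 + 2)
clock-run nil        e k = ⇓while-false refl
clock-run (cons s t) e k =
  while-cons {a = 7} {spine t * 9 + 2} refl (seq {a = 4} {3} (assign refl) (assign refl))
    (subst (λ j → clockCode ⊢ t ∷ e ∷ num (suc k) ∷ [] ⇓ nil ∷ e ∷ num j ∷ [] ∣ ticks (spine t * 9 + 2))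
      (+-suc (spine t) k) (clock-run t e (suc k)))
  -- The run lemmas used here do not mention the numeral, so 0 is an arbitrary instance.
  where open Semantics 0

module _ {n : ℕ} (G : Graph n) (1≤n : 1 ≤ n) where
  open Semantics n
  open Bounds G 1≤n

  private
    g = encodeGraph G

  -- `carry` bounds the time since the last output whenever the loop test is reached: the initial
  -- phase at first, one step and an assignment later. The sum serves for both.
  stepTime initTime carry : ℕ
  stepTime = coef stepCode * P (deg stepCode) 1
  initTime = 4 + ((n * 9 + 2) + (coef initCode * P (deg initCode) 1 + 2))
  carry    = initTime + (stepTime + 2)

  -- Beyond `carry`: 3 for the loop test, 3 for evaluating the expression written, and n * 4 + 1 for
  -- the size of an encoded subset.
  delay : ℕ
  delay = 6 + (n * 4 + 1) + carry

  -- The rest of a run after `done` has been written; `timely` starts from the time m already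
  -- elapsed since the last output.
  record Enumerated (done : List (Subset n)) (σ : Store 3) : Set where
    field
      {trace}  : Trace
      {final}  : Store 3
      {sols}   : List (Subset n)
      executes : enumerateCode ⊢ σ ⇓ final ∣ trace
      writes   : outputs trace ≡ List.map encodeSubset sols
      distinct : Unique sols
      fresh    : ∀ {D} → D ∈ˡ sols → D ∉ˡ done
      correct  : ∀ {D} → D ∈ˡ sols → MinimalConnectedDominating G D
      complete : ∀ {D} → MinimalConnectedDominating G D → D ∈ˡ sols ⊎ D ∈ˡ done
      timely   : ∀ m → m ≤ carry → All (_≤ delay) (delaysFrom m trace)

  -- Each round moves one solution to `done`, and distinct solutions number at most 2^n, so the fuel
  -- cannot run out. Expansion is recorded for `done` only; hence an empty queue leaves a closed
  -- list.
  enumerate : ∀ fuel done q vis x → Good G (q ++ done) vis →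
    (∀ {D} → D ∈ˡ done → Expanded G (q ++ done) D) → ∃[ D ] D ∈ˡ q ++ done →
    2 ^ n < fuel + length done →
    Enumerated done (state x (encodeSets G q ∷ vis ∷ g ∷ []) nil)
  enumerate fuel done [] vis x gd closed (D , D∈) lt = record
    { executes = ⇓while-false refl
    ; writes   = refl
    ; distinct = []
    ; fresh    = λ ()
    ; correct  = λ ()
    ; complete = λ mE → inj₂ (closed⇒all G (sound gd) closed D∈ mE)
    ; timely   = λ m le → ≤-trans (+-monoʳ-≤ 3 le) (+-monoˡ-≤ carry 3≤) ∷ []
    }
    where
    3≤ : 3 ≤ 6 + (n * 4 + 1)
    3≤ = s≤s (s≤s (s≤s z≤n))
  enumerate zero done (D ∷ q) vis x gd closed _ lt =
    contradiction (≤-trans (n≤1+n _) (≤-trans lt′ (unique-length-≤ uniq))) (<⇒≱ lt)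
    where
    uniq : Unique (D ∷ q ++ done)
    uniq = unique gd
    lt′ : suc (length done) ≤ length (D ∷ q ++ done)
    lt′ = s≤s (≤-trans (m≤n+m (length done) (length q)) (≤-reflexive (sym (length-++ q))))
  enumerate (suc fuel) done (D ∷ q) vis x gd closed _ lt
    with step-spec G D q vis (good-↭ (↭-sym (shift D q done)) gd)
  ... | q′ , vis′ , eq , gd′ , keep , expanded
    with enumerate fuel (D ∷ done) q′ vis′ (⟦ stepCode ⟧ (encodeSets G (D ∷ q) ∷ vis ∷ g ∷ [])) gd′
           closed′ (D , keep (∈-resp-↭ (↭-sym (shift D q done)) (here refl)))
           (<-≤-trans lt (≤-reflexive (sym (+-suc fuel (length done)))))
    where
    closed′ : ∀ {E} → E ∈ˡ D ∷ done → Expanded G (q′ ++ D ∷ done) E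
    closed′ (here refl) = expanded
    closed′ (there E∈) v v∈ X len cd =
      let N , N∈ , N⊆ = closed E∈ v v∈ X len cd
      in N , keep (∈-resp-↭ (↭-sym (shift D q done)) N∈) , N⊆
  ... | rest = record
    { executes = retick rearrange
        (⇓while-true (λ ()) (⇓⨾ ⇓output (seq (run stepCode ρ nil x) (assign refl)))
          (subst (λ t → enumerateCode ⊢ y ∷ t ∷ num n ∷ [] ⇓ R.final ∣ R.trace) (sym eq) R.executes))
    ; writes   = trans (outputs-ticks (3 + w) _)
        (cong (encodeSubset D ∷_) (trans (outputs-ticks s R.trace) R.writes))
    ; distinct = All.tabulate (λ { E∈ refl → R.fresh E∈ (here refl) }) ∷ R.distinct
    ; fresh    = λ { (here refl) → fresh-D ; (there E∈) → R.fresh E∈ ∘ there }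
    ; correct  = λ { (here refl) → sound gd (here refl) ; (there E∈) → R.correct E∈ }
    ; complete = λ mE → classify (R.complete mE)
    ; timely   = λ m le → subst (All (_≤ delay)) (sym (delaysFrom-ticks m (3 + w) _))
        (before m le ∷ subst (All (_≤ delay)) (sym (delaysFrom-ticks 0 s R.trace))
          (R.timely (s + 0) after))
    }
    where
    module R = Enumerated rest
    ρ : Store 3
    ρ = encodeSets G (D ∷ q) ∷ vis ∷ g ∷ []
    y : Tree
    y = ⟦ stepCode ⟧ ρ
    s w : ℕ
    s = steps stepCode ρ + 2
    w = 3 + size (encodeSubset D)
    rearrange : ticks 3 ++ ((ticks w ++ out (encodeSubset D) ∷ []) ++ ticks s) ++ R.trace
              ≡ ticks (3 + w) ++ out (encodeSubset D) ∷ (ticks s ++ R.trace)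
    rearrange = cong (ticks 3 ++_) (trans (++-assoc (ticks w ++ _) (ticks s) R.trace)
      (++-assoc (ticks w) _ (ticks s ++ R.trace)))
    fresh-D : ¬ (D ∈ˡ done)
    fresh-D D∈ with unique gd
    ... | D∉ ∷ _ = All.lookup D∉ (∈-++⁺ʳ q D∈) refl
    classify : ∀ {E} → E ∈ˡ R.sols ⊎ E ∈ˡ D ∷ done → E ∈ˡ D ∷ R.sols ⊎ E ∈ˡ done
    classify (inj₁ E∈) = inj₁ (there E∈)
    classify (inj₂ (here eq)) = inj₁ (here eq)
    classify (inj₂ (there E∈)) = inj₂ E∈
    before : ∀ m → m ≤ carry → 3 + w + m ≤ delay
    before m le = +-mono-≤ (s≤s (s≤s (s≤s (+-monoʳ-≤ 3 (size-encodeSubset D))))) le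
    after : s + 0 ≤ carry
    after = ≤-trans (≤-reflexive (+-identityʳ s))
      (≤-trans (+-monoˡ-≤ 2 (unbound (step-bound D (encodeSets G q) vis)))
        (m≤n+m (stepTime + 2) initTime))

  enumerator-correct : Connected G →
    EnumeratesWithDelay enumerator g encodeSubset (MinimalConnectedDominating G) delay
  enumerator-correct conn
    with init-spec G (Covering⇒Dominating G (λ v → v , ∈⊤ , inj₁ refl) , conn)
  ... | D , vis , eq , gd
    with enumerate (suc (2 ^ n)) [] (D ∷ []) vis (⟦ initCode ⟧ (g ∷ [])) gd (λ ()) (D , here refl)
           (m≤m+n _ 0)
  ... | result =
    _ , R.sols , (R.final , ⇓⨾ (assign refl) (⇓⨾ clocked (⇓⨾ (run initCode (g ∷ []) nil nil)
      (⇓⨾ (assign refl)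
        (subst (λ t → enumerateCode ⊢ ⟦ initCode ⟧ (g ∷ []) ∷ t ∷ num n ∷ [] ⇓ R.final ∣ R.trace)
          (sym eq) R.executes))))) ,
    trans (cong outputs prefix) (trans (outputs-ticks total R.trace) R.writes) , R.distinct ,
    (λ E → mk⇔ R.correct λ mE → [ id , (λ ()) ]′ (R.complete mE)) ,
    subst (All (_≤ delay) ∘ delays) (sym prefix)
      (subst (All (_≤ delay)) (sym (delaysFrom-ticks 0 total R.trace)) (R.timely (total + 0) early))
    where
    module R = Enumerated result
    clocked : clockCode ⊢ g ∷ cons g nil ∷ nil ∷ [] ⇓ nil ∷ cons g nil ∷ num n ∷ [] ∣ ticks (n * 9 + 2)
    clocked = subst₂ (λ j k → clockCode ⊢ g ∷ cons g nil ∷ nil ∷ [] ⇓ nil ∷ cons g nil ∷ num k ∷ [] ∣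
                         ticks (j * 9 + 2))
      vertices (trans (+-identityʳ (spine g)) vertices) (clock-run g (cons g nil) 0)
      where
      vertices : spine g ≡ n
      vertices = trans (spine-encodeList _ (allFin n)) (length-tabulate id)
    s total : ℕ
    s = steps initCode (g ∷ [])
    total = 4 + ((n * 9 + 2) + (s + 2))
    prefix : ticks 4 ++ ticks (n * 9 + 2) ++ ticks s ++ ticks 2 ++ R.trace ≡ ticks total ++ R.trace
    prefix = cong (ticks 4 ++_) (trans
      (cong (ticks (n * 9 + 2) ++_) (trans (sym (++-assoc (ticks s) (ticks 2) R.trace))
        (cong (_++ R.trace) (ticks-+ s 2))))
      (trans (sym (++-assoc (ticks (n * 9 + 2)) (ticks (s + 2)) R.trace))
        (cong (_++ R.trace) (ticks-+ (n * 9 + 2) (s + 2)))))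
    early : total + 0 ≤ carry
    early = ≤-trans (≤-reflexive (+-identityʳ total))
      (≤-trans (+-monoʳ-≤ 4 (+-monoʳ-≤ (n * 9 + 2) (+-monoˡ-≤ 2 (unbound init-bound))))
        (m≤m+n initTime (stepTime + 2)))

  delay-bound : Bound delay delayCoef delayDeg 1
  delay-bound =
    (const≤ 6 _ _ ⊕ (linear 4 ⊕ const≤ 1 _ _)) ⊕
    ((const≤ 4 _ _ ⊕ ((linear 9 ⊕ const≤ 2 _ _) ⊕
       (widen (≤-trans (m≤m⊔n (deg initCode) (deg stepCode)) deg≤) ≤-refl
         (bound {x = coef initCode} ≤-refl) ⊕ const≤ 2 _ _))) ⊕
     (widen (≤-trans (m≤n⊔m (deg initCode) (deg stepCode)) deg≤) ≤-refl
       (bound {x = coef stepCode} ≤-refl) ⊕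
       const≤ 2 _ _))
    where
    deg≤ : deg initCode ⊔ deg stepCode ≤ delayDeg
    deg≤ = m≤n⊔m 1 (deg initCode ⊔ deg stepCode)
    linear : ∀ k → Bound (n * k) k delayDeg 1
    linear k = widen (m≤m⊔n 1 (deg initCode ⊔ deg stepCode)) z≤n (bound (≤-reflexive
      (trans (*-comm n k) (cong (k *_) (sym (trans (*-identityʳ (n ^ 1)) (*-identityʳ n)))))))

-- c is a factor as well as part of the exponent: for n = 1 all powers are 1, and only a factor can
-- account for the constant delay.
theorem6 : ∃[ P ] ∃[ c ] (∀ (n : ℕ) (G : Graph n) → Connected G →
    EnumeratesWithDelay P (encodeGraph G) encodeSubset (MinimalConnectedDominating G)
    (c * n ^ (3 * maxDegree G + c)))
theorem6 = enumerator , delayCoef + exponent , λ n G conn → weaken G conn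
  where
  exponent : ℕ
  -- `delayDeg` comes from the clock folds, 2 from the exponent of M.
  exponent = delayDeg + 2

  weaken : ∀ {n} (G : Graph n) → Connected G →
    EnumeratesWithDelay enumerator (encodeGraph G) encodeSubset (MinimalConnectedDominating G)
      ((delayCoef + exponent) * n ^ (3 * maxDegree G + (delayCoef + exponent)))
  weaken {n} G conn@((x , _) , _) =
    let τ , xs , runs , outs , uniq , sols , delays≤ = enumerator-correct G 1≤n conn
    in τ , xs , runs , outs , uniq , sols , All.map (λ le → ≤-trans le delay≤) delays≤
    where
    1≤n : 1 ≤ n
    1≤n = ≤-trans (s≤s z≤n) (toℕ<n x)
    instance
      n≢0 : NonZero n
      n≢0 = >-nonZero 1≤n
    open Bounds G 1≤n using (unbound)
    d e c : ℕ
    d = delayDeg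
    e = 3 * maxDegree G
    c = delayCoef + exponent
    exponent≤ : d + (e + 2) ≤ e + c
    exponent≤ = ≤-trans (≤-reflexive (trans (sym (+-assoc d e 2))
        (trans (cong (_+ 2) (+-comm d e)) (+-assoc e d 2))))
      (+-monoʳ-≤ e (m≤n+m exponent delayCoef))
    delay≤ : delay G 1≤n ≤ c * n ^ (e + c)
    delay≤ = begin
      delay G 1≤n
        ≤⟨ unbound (delay-bound G 1≤n) ⟩
      delayCoef * (n ^ d * (n ^ (e + 2)) ^ 1)
        ≡⟨ cong (λ t → delayCoef * (n ^ d * t)) (^-identityʳ (n ^ (e + 2))) ⟩
      delayCoef * (n ^ d * n ^ (e + 2))
        ≡⟨ cong (delayCoef *_) (^-distribˡ-+-* n d (e + 2)) ⟨
      delayCoef * n ^ (d + (e + 2))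
        ≤⟨ *-mono-≤ (m≤m+n delayCoef exponent) (^-monoʳ-≤ n exponent≤) ⟩
      c * n ^ (e + c) ∎
      where open ≤-Reasoning
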